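{- Let $0<p<1$ and let $X_1,\ldots,X_n$ be independent random variables, each following the same distribution as a random variable $X\sim b(p)$. Let $S_n=\sum_{i=1}^n X_i$. Then, for any $r$ such that $0<r<p$, $$P(S_n\le rn)\le\exp\left(-D(r\|p)\,n\right)=\left[\left(\frac{p}{r}\right)^r\left(\frac{1-p}{1-r}\right)^{1-r}\right]^n .$$
   Context: $b(p)$ denotes the Bernoulli distribution with $P(X=1)=p$, $P(X=0)=1-p$. For $r,p\in(0,1)$, $D(r\|p)$ is the Kullback-Leibler divergence between the two-point distributions $(r,1-r)$ and $(p,1-p)$, i.e. $D(r\|p)=r\ln\frac{r}{p}+(1-r)\ln\frac{1-r}{1-p}$. Here $n\ge 1$ is an integer. -}

module Defs where

open import Algebra.Bundles using (CommutativeRing; Semiring)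
import Algebra.Definitions.RawSemiring as RawSemiringDefinitions
open import Data.Fin.Base using (Fin; toℕ)
open import Data.Nat.Base as ℕ using (ℕ; _!)
open import Data.Product.Base using (∃; _×_)
open import Level using (0ℓ)
open import Relation.Binary.Core using (Rel)
import Relation.Binary.Construct.NonStrictToStrict as NonStrictToStrict
open import Relation.Binary.PropositionalEquality.Core using (_≢_)
open import Relation.Binary.Structures using (IsDecTotalOrder)
open import Relation.Unary using (Pred; _∈_; _≐_; _⊥_; U; ∅; ∁; ⋃; ⋂)

-- The real numbers, axiomatised as a Dedekind-complete ordered field.  Up to
-- isomorphism ℝ is the only one, so quantifying over this record fixes ℝ.  The
-- axioms are those of classical analysis: the order is decidable and every
-- inhabited bounded predicate has a supremum.
record RealNumbers : Set₁ where
  field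
    commutativeRing : CommutativeRing 0ℓ 0ℓ

  open CommutativeRing commutativeRing public renaming (Carrier to ℝ)
  open RawSemiringDefinitions (Semiring.rawSemiring semiring) public
    using (_^_; sum; product) renaming (_×_ to _·_)

  infix 4 _≤_
  infix 8 _⁻¹
  field
    _≤_             : Rel ℝ 0ℓ
    isDecTotalOrder : IsDecTotalOrder _≈_ _≤_
    +-monoˡ-≤       : ∀ {x y} z → x ≤ y → x + z ≤ y + z
    *-nonNegative   : ∀ {x y} → 0# ≤ x → 0# ≤ y → 0# ≤ x * y

    0≉1             : 0# ≉ 1#
    -- Total for convenience; the value at 0 is unspecified.
    _⁻¹             : ℝ → ℝ
    *-inverseʳ      : ∀ {x} → x ≉ 0# → x * x ⁻¹ ≈ 1#

  open NonStrictToStrict _≈_ _≤_ public using (_<_)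

  UpperBound : Pred ℝ 0ℓ → Pred ℝ 0ℓ
  UpperBound A u = ∀ {x} → x ∈ A → x ≤ u

  -- Being the least upper bound is expressed positively: anything strictly
  -- below s is exceeded by an element of A.
  IsSupremum : Pred ℝ 0ℓ → Pred ℝ 0ℓ
  IsSupremum A s = UpperBound A s × (∀ {u} → u < s → ∃ λ x → x ∈ A × u < x)

  field
    complete : ∀ (A : Pred ℝ 0ℓ) → ∃ A → ∃ (UpperBound A) → ∃ (IsSupremum A)

  infixl 7 _/_
  _/_ : ℝ → ℝ → ℝ
  x / y = x * y ⁻¹

  fromℕ : ℕ → ℝ
  fromℕ n = n · 1#

  infix 4 _⟶_
  _⟶_ : (ℕ → ℝ) → ℝ → Set
  a ⟶ l = ∀ ε → 0# < ε → ∃ λ N → ∀ n → N ℕ.≤ n → l - ε < a n × a n < l + ε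

  partialSum : (ℕ → ℝ) → ℕ → ℝ
  partialSum a n = sum {n} (λ k → a (toℕ k))

  -- Borel sets of ℝ, generated by the rays (-∞, a].
  data Borel : Pred ℝ 0ℓ → Set₁ where
    ray        : ∀ a → Borel (_≤ a)
    complement : ∀ {B} → Borel B → Borel (∁ B)
    union      : ∀ {B : ℕ → Pred ℝ 0ℓ} → (∀ k → Borel (B k)) → Borel (⋃ ℕ B)
    resp       : ∀ {B C} → B ≐ C → Borel B → Borel C

-- Each of the two functions is determined by its defining property (ln only at
-- positive arguments, the values elsewhere being unspecified).
record ExpLog (𝓡 : RealNumbers) : Set where
  open RealNumbers 𝓡

  field
    exp        : ℝ → ℝ
    exp-series : ∀ x → partialSum (λ k → x ^ k / fromℕ (k !)) ⟶ exp x
    ln         : ℝ → ℝ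
    exp-ln     : ∀ {x} → 0# < x → exp (ln x) ≈ x

  -- Real power of a positive base.
  infixr 8 _^ʳ_
  _^ʳ_ : ℝ → ℝ → ℝ
  x ^ʳ a = exp (a * ln x)

  -- The divergence D(r‖p) between (r, 1 - r) and (p, 1 - p).
  D : ℝ → ℝ → ℝ
  D r p = r * ln (r / p) + (1# - r) * ln ((1# - r) / (1# - p))

record ProbabilitySpace (𝓡 : RealNumbers) : Set₂ where
  open RealNumbers 𝓡

  field
    Ω          : Set
    Measurable : Pred Ω 0ℓ → Set₁

    measurable-U    : Measurable U
    measurable-∁    : ∀ {A} → Measurable A → Measurable (∁ A)
    measurable-⋃    : ∀ {A : ℕ → Pred Ω 0ℓ} → (∀ k → Measurable (A k)) →
                      Measurable (⋃ ℕ A)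
    measurable-resp : ∀ {A B} → A ≐ B → Measurable A → Measurable B

    -- Defined on all subsets for convenience, but subject to the axioms of a
    -- measure only on the measurable ones.
    ℙ          : Pred Ω 0ℓ → ℝ
    ℙ-cong     : ∀ {A B} → A ≐ B → ℙ A ≈ ℙ B
    ℙ-nonNeg   : ∀ {A} → Measurable A → 0# ≤ ℙ A
    ℙ-∅        : ℙ ∅ ≈ 0#
    ℙ-U        : ℙ U ≈ 1#
    ℙ-union    : ∀ {A : ℕ → Pred Ω 0ℓ} → (∀ k → Measurable (A k)) →
                 (∀ {j k} → j ≢ k → A j ⊥ A k) →
                 partialSum (λ k → ℙ (A k)) ⟶ ℙ (⋃ ℕ A)

  IsRandomVariable : (Ω → ℝ) → Set₁
  IsRandomVariable X = ∀ {B} → Borel B → Measurable (λ ω → X ω ∈ B)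

  Independent : ∀ {n} → (Fin n → Ω → ℝ) → Set₁
  Independent {n} X = ∀ (B : Fin n → Pred ℝ 0ℓ) → (∀ i → Borel (B i)) →
    ℙ (⋂ (Fin n) (λ i ω → X i ω ∈ B i)) ≈ product (λ i → ℙ (λ ω → X i ω ∈ B i))

  ∑ : ∀ {n} → (Fin n → Ω → ℝ) → Ω → ℝ
  ∑ X ω = sum (λ i → X i ω)

  record _∼b_ (X : Ω → ℝ) (p : ℝ) : Set where
    field
      ℙ-one  : ℙ (λ ω → X ω ≈ 1#) ≈ p
      ℙ-zero : ℙ (λ ω → X ω ≈ 0#) ≈ 1# - p

{-# OPTIONS --safe #-}
module Submission where

-- Change of measure from p to r.  For v ∈ {0,1}ⁿ with k ones, the p-probability of v is its
-- r-probability times exp(-Λ(v)), where Λ(v) = k ln(r/p) + (n - k) ln((1-r)/(1-p)).  As r < p, Λ is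
-- decreasing in k and equals n D(r‖p) at k = r n; hence every outcome with k ≤ r n is at most
-- exp(-n D(r‖p)) times as likely under p as under r, and the r-probabilities add up to 1.
-- The functional equation of exp comes from the Cauchy product of its series: for ∣x∣ ≤ u and ∣y∣ ≤ v
-- the terms outside the triangle i + j < n are dominated by those for u and v, which amount to at most
-- a difference of two partial sums of exp (u + v).

open import Defs
open import Algebra.Bundles using (CommutativeRing)
import Algebra.Properties.AbelianGroup as AbelianGroupProperties
import Algebra.Properties.CommutativeSemiring.Binomial as Binomial
import Algebra.Properties.Monoid.Sum as MonoidSum
import Algebra.Properties.Ring as RingProperties
import Algebra.Properties.Semiring.Exp as SemiringExp
import Algebra.Properties.Semiring.Mult as SemiringMult
import Algebra.Properties.Semiring.Mult.TCOptimised as SemiringMultTC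
import Algebra.Properties.Semiring.Sum as SemiringSum
import Algebra.Solver.Ring
open import Algebra.Solver.Ring.AlmostCommutativeRing
  using (fromCommutativeRing; _-Raw-AlmostCommutative⟶_)
open import Data.Bool.Base using (Bool; true; false)
open import Data.Fin.Base as Fin using (Fin; toℕ)
import Data.Fin.Properties as Fin
open import Data.Integer.Base as ℤ using (ℤ; +_; -[1+_])
import Data.Integer.Properties as ℤ
open import Data.Maybe.Base using (Maybe; just; nothing)
open import Data.Nat.Base as ℕ using (ℕ; zero; suc; _!; _∸_)
open import Data.Nat.Combinatorics using (nCk≡n!/k![n-k]!; k![n∸k]!∣n!) renaming (_C_ to _choose_)
open import Data.Nat.DivMod using (m/n*n≡m)
import Data.Nat.Properties as ℕ
open import Data.Product.Base using (∃; _×_; _,_; proj₁; proj₂)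
open import Data.Sum.Base using (_⊎_; inj₁; inj₂; [_,_]′)
open import Data.Vec.Functional using (_∷_)
open import Function.Base using (_∘_)
open import Level using (0ℓ)
open import Relation.Binary.Bundles using (DecTotalOrder)
open import Relation.Binary.PropositionalEquality.Core as ≡ using (_≡_)
import Relation.Binary.Properties.Poset as PosetProperties
import Relation.Binary.Reasoning.PartialOrder as PartialOrderReasoning
import Relation.Binary.Reasoning.Setoid as SetoidReasoning
open import Relation.Nullary using (Dec; yes; no; ¬_; ¬?; contradiction; _×-dec_; _⊎-dec_)
open import Relation.Unary using (Pred; Decidable; _⊆_; _≐_; _⊥_; _∩_; _∪_; U; ∅; ∁; ⋃; ⋂)

-- `ℙ` obeys the laws of a measure only on measurable sets, so the tail event has to be shown
-- measurable, although measurability is given for each `X i` and not for their sum; rational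
-- thresholds supply this. The law `X ∼b p` fixes the probabilities of the values 1 and 0 but leaves
-- other values possible on a null set, so splitting along a trial always discards a null event. No
-- probability space for r is built: the numbers `weight r`, which add up to 1, suffice, and the
-- outcomes are summed by splitting along one trial at a time rather than by a sum over the
-- functions `Fin n → Bool`. On the analytic side `exp` is known through its series alone and `ln`
-- through `exp-ln` alone. Positivity, monotonicity and injectivity of `exp` are therefore derived,
-- from the functional equation and from 1 + x ≤ exp x for x ≥ 0, before anything about logarithms
-- is available.

-- A ring solver with integer coefficients for an arbitrary commutative ring.

module IntegerCoefficients {c ℓ} (R : CommutativeRing c ℓ) where
  open CommutativeRing R
  open SemiringMultTC semiring using (1+×; ×-homo-+; ×1-homo-*) renaming (_×_ to _·_)
  open RingProperties ring using (-‿distribˡ-*; -‿distribʳ-*; -‿involutive; -0#≈0#)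
  open AbelianGroupProperties +-abelianGroup using () renaming (⁻¹-∙-comm to -‿+-comm)
  open SetoidReasoning setoid

  -- The multiple is the variant for which `1 · x` reduces to `x`, so the solver constants
  -- `con (+ 0)` and `con (+ 1)` are definitionally `0#` and `1#`.
  ⟦_⟧ : ℤ → Carrier
  ⟦ + n ⟧      = n · 1#
  ⟦ -[1+ n ] ⟧ = - (suc n · 1#)

  ⊖-homo : ∀ m n → ⟦ m ℤ.⊖ n ⟧ ≈ m · 1# - n · 1#
  ⊖-homo zero    zero    = sym (-‿inverseʳ 0#)
  ⊖-homo zero    (suc n) = sym (+-identityˡ _)
  ⊖-homo (suc m) zero    = sym (trans (+-congˡ -0#≈0#) (+-identityʳ _))
  ⊖-homo (suc m) (suc n) = begin
    ⟦ suc m ℤ.⊖ suc n ⟧               ≡⟨ ≡.cong ⟦_⟧ (ℤ.[1+m]⊖[1+n]≡m⊖n m n) ⟩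
    ⟦ m ℤ.⊖ n ⟧                       ≈⟨ ⊖-homo m n ⟩
    m · 1# - n · 1#                   ≈⟨ +-congʳ (+-identityˡ _) ⟨
    (0# + m · 1#) - n · 1#            ≈⟨ +-congʳ (+-congʳ (-‿inverseʳ 1#)) ⟨
    ((1# - 1#) + m · 1#) - n · 1#     ≈⟨ +-congʳ (+-assoc 1# (- 1#) _) ⟩
    (1# + (- 1# + m · 1#)) - n · 1#   ≈⟨ +-congʳ (+-congˡ (+-comm _ _)) ⟩
    (1# + (m · 1# - 1#)) - n · 1#     ≈⟨ +-congʳ (+-assoc _ _ _) ⟨
    ((1# + m · 1#) - 1#) - n · 1#     ≈⟨ +-assoc _ _ _ ⟩
    (1# + m · 1#) + (- 1# - n · 1#)   ≈⟨ +-congˡ (-‿+-comm _ _) ⟩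
    (1# + m · 1#) - (1# + n · 1#)     ≈⟨ +-cong (1+× m 1#) (-‿cong (1+× n 1#)) ⟨
    suc m · 1# - suc n · 1#           ∎

  +-homo : ∀ i j → ⟦ i ℤ.+ j ⟧ ≈ ⟦ i ⟧ + ⟦ j ⟧
  +-homo (+ m)      (+ n)      = ×-homo-+ 1# m n
  +-homo (+ m)      -[1+ n ]   = ⊖-homo m (suc n)
  +-homo -[1+ m ]   (+ n)      = trans (⊖-homo n (suc m)) (+-comm _ _)
  +-homo -[1+ m ]   -[1+ n ]   = begin
    - (suc (suc (m ℕ.+ n)) · 1#)      ≡⟨ ≡.cong (λ k → - (k · 1#)) (ℕ.+-suc (suc m) n) ⟨
    - ((suc m ℕ.+ suc n) · 1#)        ≈⟨ -‿cong (×-homo-+ 1# (suc m) (suc n)) ⟩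
    - (suc m · 1# + suc n · 1#)       ≈⟨ -‿+-comm _ _ ⟨
    - (suc m · 1#) - suc n · 1#       ∎

  -‿homo : ∀ i → ⟦ ℤ.- i ⟧ ≈ - ⟦ i ⟧
  -‿homo (+ zero)  = sym -0#≈0#
  -‿homo (+ suc n) = refl
  -‿homo -[1+ n ]  = sym (-‿involutive _)

  *-homo⁺ : ∀ m j → ⟦ + m ℤ.* j ⟧ ≈ m · 1# * ⟦ j ⟧
  *-homo⁺ m (+ n)    = trans (reflexive (≡.cong ⟦_⟧ (≡.sym (ℤ.pos-* m n)))) (×1-homo-* m n)
  *-homo⁺ m -[1+ n ] = begin
    ⟦ + m ℤ.* -[1+ n ] ⟧          ≡⟨ ≡.cong ⟦_⟧ (ℤ.neg-distribʳ-* (+ m) (+ suc n)) ⟨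
    ⟦ ℤ.- (+ m ℤ.* + suc n) ⟧     ≈⟨ -‿homo (+ m ℤ.* + suc n) ⟩
    - ⟦ + m ℤ.* + suc n ⟧         ≈⟨ -‿cong (*-homo⁺ m (+ suc n)) ⟩
    - (m · 1# * (suc n · 1#))     ≈⟨ -‿distribʳ-* _ _ ⟩
    m · 1# * (- (suc n · 1#))     ∎

  *-homo : ∀ i j → ⟦ i ℤ.* j ⟧ ≈ ⟦ i ⟧ * ⟦ j ⟧
  *-homo (+ m)    j = *-homo⁺ m j
  *-homo -[1+ m ] j = begin
    ⟦ -[1+ m ] ℤ.* j ⟧            ≡⟨ ≡.cong ⟦_⟧ (ℤ.neg-distribˡ-* (+ suc m) j) ⟨
    ⟦ ℤ.- (+ suc m ℤ.* j) ⟧       ≈⟨ -‿homo (+ suc m ℤ.* j) ⟩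
    - ⟦ + suc m ℤ.* j ⟧           ≈⟨ -‿cong (*-homo⁺ (suc m) j) ⟩
    - (suc m · 1# * ⟦ j ⟧)        ≈⟨ -‿distribˡ-* _ _ ⟩
    - (suc m · 1#) * ⟦ j ⟧        ∎

  morphism : ℤ.+-*-rawRing -Raw-AlmostCommutative⟶ fromCommutativeRing R
  morphism = record
    { ⟦_⟧ = ⟦_⟧ ; +-homo = +-homo ; *-homo = *-homo ; -‿homo = -‿homo
    ; 0-homo = refl ; 1-homo = refl }

  ⟦⟧-weaklyDec : ∀ i j → Maybe (⟦ i ⟧ ≈ ⟦ j ⟧)
  ⟦⟧-weaklyDec i j with i ℤ.≟ j
  ... | yes ≡.refl = just refl
  ... | no  _      = nothing

  open Algebra.Solver.Ring ℤ.+-*-rawRing (fromCommutativeRing R) morphism ⟦⟧-weaklyDec public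
    using (solve; _:+_; _:*_; _:-_; :-_; con; _:=_)

-- Arithmetic of inequalities in an ordered field.

module OrderedField (𝓡 : RealNumbers) where
  open RealNumbers 𝓡
  open IntegerCoefficients commutativeRing public using (solve; _:+_; _:*_; _:-_; :-_; con; _:=_)

  decTotalOrder : DecTotalOrder _ _ _
  decTotalOrder = record { isDecTotalOrder = isDecTotalOrder }

  open DecTotalOrder decTotalOrder public
    using (_≤?_; _≟_; total; antisym; poset; ≤-respʳ-≈; ≤-respˡ-≈)
    renaming (refl to ≤-refl; reflexive to ≤-reflexive; trans to ≤-trans)
  open PosetProperties poset public using (<⇒≱; <-respʳ-≈; <-respˡ-≈)

  module ≤-Reasoning = PartialOrderReasoning poset

  private variable w x y z : ℝ

  ≰⇒> : ¬ x ≤ y → y < x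
  ≰⇒> {x} {y} x≰y with total x y
  ... | inj₁ x≤y = contradiction x≤y x≰y
  ... | inj₂ y≤x = y≤x , λ y≈x → x≰y (≤-reflexive (sym y≈x))

  <⇒≤ : x < y → x ≤ y
  <⇒≤ = proj₁

  0≤y-x : x ≤ y → 0# ≤ y - x
  0≤y-x {x} {y} x≤y = ≤-respˡ-≈ (-‿inverseʳ x) (+-monoˡ-≤ (- x) x≤y)

  -- Reduces an inequality to a nonnegative expression for the difference of its sides, leaving a
  -- polynomial identity to the solver. Most inequalities below are obtained in this way, the strict
  -- ones through `<-by`.
  ≤-by : 0# ≤ z → z ≈ y - x → x ≤ y
  ≤-by {z} {y} {x} 0≤z z≈y-x = begin
    x          ≈⟨ +-identityˡ x ⟨
    0# + x     ≤⟨ +-monoˡ-≤ x 0≤z ⟩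
    z + x      ≈⟨ +-congʳ z≈y-x ⟩
    y - x + x  ≈⟨ solve 2 (λ x y → y :- x :+ x := y) refl x y ⟩
    y          ∎
    where open ≤-Reasoning

  x≈y⇒x-y≈0 : x ≈ y → x - y ≈ 0#
  x≈y⇒x-y≈0 {x} {y} x≈y = trans (+-congʳ x≈y) (-‿inverseʳ y)

  0<y-x : x < y → 0# < y - x
  0<y-x {x} {y} (x≤y , x≉y) = 0≤y-x x≤y , λ 0≈y-x → x≉y (begin-equality
    x            ≈⟨ +-identityˡ x ⟨
    0# + x       ≈⟨ +-congʳ 0≈y-x ⟩
    y - x + x    ≈⟨ solve 2 (λ x y → y :- x :+ x := y) refl x y ⟩
    y            ∎)
    where open ≤-Reasoning

  <-by : 0# < z → z ≈ y - x → x < y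
  <-by (0≤z , 0≉z) z≈y-x =
    ≤-by 0≤z z≈y-x , λ x≈y → 0≉z (trans (sym (x≈y⇒x-y≈0 (sym x≈y))) (sym z≈y-x))

  0≤x+y : 0# ≤ x → 0# ≤ y → 0# ≤ x + y
  0≤x+y {x} {y} 0≤x 0≤y = ≤-trans 0≤y (≤-by 0≤x (solve 2 (λ x y → x := x :+ y :- y) refl x y))

  0<x+y : 0# < x → 0# ≤ y → 0# < x + y
  0<x+y {x} {y} 0<x 0≤y = begin-strict
    0#      ≤⟨ 0≤y ⟩
    y       <⟨ <-by 0<x (solve 2 (λ x y → x := x :+ y :- y) refl x y) ⟩
    x + y   ∎
    where open ≤-Reasoning

  +-mono-≤ : w ≤ x → y ≤ z → w + y ≤ x + z
  +-mono-≤ {w} {x} {y} {z} w≤x y≤z = ≤-by (0≤x+y (0≤y-x w≤x) (0≤y-x y≤z))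
    (solve 4 (λ w x y z → (x :- w) :+ (z :- y) := (x :+ z) :- (w :+ y)) refl w x y z)

  *-monoˡ-≤ : 0# ≤ z → x ≤ y → z * x ≤ z * y
  *-monoˡ-≤ {z} {x} {y} 0≤z x≤y = ≤-by (*-nonNegative 0≤z (0≤y-x x≤y))
    (solve 3 (λ x y z → z :* (y :- x) := z :* y :- z :* x) refl x y z)

  *-monoʳ-≤ : 0# ≤ z → x ≤ y → x * z ≤ y * z
  *-monoʳ-≤ {z} {x} {y} 0≤z x≤y = ≤-by (*-nonNegative 0≤z (0≤y-x x≤y))
    (solve 3 (λ x y z → z :* (y :- x) := y :* z :- x :* z) refl x y z)

  pos⇒≉0 : 0# < x → x ≉ 0#
  pos⇒≉0 (_ , 0≉x) x≈0 = 0≉x (sym x≈0)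

  *-inverseˡ : x ≉ 0# → x ⁻¹ * x ≈ 1#
  *-inverseˡ x≉0 = trans (*-comm _ _) (*-inverseʳ x≉0)

  *-cancelˡ : x ≉ 0# → x * y ≈ x * z → y ≈ z
  *-cancelˡ {x} {y} {z} x≉0 xy≈xz = begin-equality
    y               ≈⟨ lemma y ⟩
    x ⁻¹ * (x * y)  ≈⟨ *-congˡ xy≈xz ⟩
    x ⁻¹ * (x * z)  ≈⟨ lemma z ⟨
    z               ∎
    where
    open ≤-Reasoning
    lemma : ∀ y → y ≈ x ⁻¹ * (x * y)
    lemma y = trans (sym (*-identityˡ y)) (trans (*-congʳ (sym (*-inverseˡ x≉0))) (*-assoc _ _ _))

  0<x*y : 0# < x → 0# < y → 0# < x * y
  0<x*y 0<x (0≤y , 0≉y) =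
    *-nonNegative (<⇒≤ 0<x) 0≤y ,
    λ 0≈xy → 0≉y (*-cancelˡ (pos⇒≉0 0<x) (trans (zeroʳ _) 0≈xy))

  *-cancelˡ-≤ : 0# < z → z * x ≤ z * y → x ≤ y
  *-cancelˡ-≤ {z} {x} {y} 0<z zx≤zy with x ≤? y
  ... | yes x≤y = x≤y
  ... | no  x≰y = contradiction zx≤zy (<⇒≱ (<-by (0<x*y 0<z (0<y-x (≰⇒> x≰y)))
    (solve 3 (λ x y z → z :* (x :- y) := z :* x :- z :* y) refl x y z)))

  *-monoˡ-< : 0# < z → x < y → z * x < z * y
  *-monoˡ-< {z} {x} {y} 0<z x<y = <-by (0<x*y 0<z (0<y-x x<y))
    (solve 3 (λ x y z → z :* (y :- x) := z :* y :- z :* x) refl x y z)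

  0≤1 : 0# ≤ 1#
  0≤1 with total 0# 1#
  ... | inj₁ 0≤1 = 0≤1
  ... | inj₂ 1≤0 = ≤-respʳ-≈
    (solve 0 ((con (+ 0) :- con (+ 1)) :* (con (+ 0) :- con (+ 1)) := con (+ 1)) refl)
                     (*-nonNegative (0≤y-x 1≤0) (0≤y-x 1≤0))

  0<1 : 0# < 1#
  0<1 = 0≤1 , 0≉1

-- The Archimedean property and the density of the rationals.

module Archimedean (𝓡 : RealNumbers) where
  open RealNumbers 𝓡
  open OrderedField 𝓡
  open ≤-Reasoning

  private variable x y z : ℝ

  *-cancelˡ-< : 0# < z → z * x < z * y → x < y
  *-cancelˡ-< {z} {x} {y} 0<z zx<zy with y ≤? x
  ... | no  y≰x = ≰⇒> y≰x
  ... | yes y≤x = contradiction (*-monoˡ-≤ (<⇒≤ 0<z) y≤x) (<⇒≱ zx<zy)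

  0<x⁻¹ : 0# < x → 0# < x ⁻¹
  0<x⁻¹ {x} 0<x = *-cancelˡ-< 0<x (begin-strict
    x * 0#    ≈⟨ zeroʳ x ⟩
    0#        <⟨ 0<1 ⟩
    1#        ≈⟨ *-inverseʳ (pos⇒≉0 0<x) ⟨
    x * x ⁻¹  ∎)

  x<x+1 : x < x + 1#
  x<x+1 {x} = <-by 0<1 (solve 2 (λ x y → y := x :+ y :- x) refl x 1#)

  0≤fromℕ : ∀ n → 0# ≤ fromℕ n
  0≤fromℕ zero    = ≤-refl
  0≤fromℕ (suc n) = 0≤x+y 0≤1 (0≤fromℕ n)

  0<fromℕ : ∀ n .{{_ : ℕ.NonZero n}} → 0# < fromℕ n
  0<fromℕ (suc n) = 0<x+y 0<1 (0≤fromℕ n)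

  -- Completeness is applied to the reals that lie below x and below some natural number. The cut at
  -- x makes this set bounded without any assumption on the naturals. If n exceeds its supremum
  -- minus 1, then n + 1 exceeds the supremum, hence is not in the set, hence exceeds x.
  archimedean : ∀ x → ∃ λ n → x < fromℕ n
  archimedean x with 0# ≤? x
  ... | no  0≰x = 0 , ≰⇒> 0≰x
  ... | yes 0≤x
    with complete (λ y → y ≤ x × ∃ λ n → y ≤ fromℕ n) (0# , 0≤x , 0 , ≤-refl) (x , proj₁)
  ... | s , upper , approx
    with approx {s - 1#} (<-by 0<1 (solve 2 (λ s o → o := s :- (s :- o)) refl s 1#))
  ... | y , (_ , n , y≤n) , s-1<y with fromℕ (suc n) ≤? x
  ... | no  1+n≰x = suc n , ≰⇒> 1+n≰x
  ... | yes 1+n≤x = contradiction (upper (1+n≤x , suc n , ≤-refl)) (<⇒≱ (begin-strict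
    s             ≈⟨ solve 2 (λ s o → s := o :+ (s :- o)) refl s 1# ⟩
    1# + (s - 1#)
      <⟨ <-by (0<y-x s-1<y) (solve 3 (λ o x y → y :- x := (o :+ y) :- (o :+ x)) refl 1# (s - 1#) y) ⟩
    1# + y        ≤⟨ +-mono-≤ ≤-refl y≤n ⟩
    fromℕ (suc n) ∎))

  ceiling : ∀ n {x} → 0# ≤ x → x < fromℕ n → ∃ λ j → x < fromℕ j × fromℕ j ≤ x + 1#
  ceiling zero        0≤x x<0 = contradiction 0≤x (<⇒≱ x<0)
  ceiling (suc n) {x} 0≤x x<1+n with fromℕ n ≤? x
  ... | no  n≰x = ceiling n 0≤x (≰⇒> n≰x)
  ... | yes n≤x = suc n , x<1+n , ≤-respʳ-≈ (+-comm 1# x) (+-mono-≤ ≤-refl n≤x)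

  -- Rationals are indexed by three naturals, the numerator being a difference, so that a union over
  -- all of them is an iterated `measurable-⋃`.
  fraction : ℕ → ℕ → ℕ → ℝ
  fraction j m k = (fromℕ j - fromℕ m) / fromℕ (suc k)

  -- The denominator c = k + 1 is so large that c (y - x) > 1, and m shifts c x into the nonnegative
  -- range where `ceiling` applies. The integer j - m then lies above c x and at most at c x + 1,
  -- hence below c y.
  fraction-dense : x < y → ∃ λ j → ∃ λ m → ∃ λ k → x < fraction j m k × fraction j m k < y
  fraction-dense {x} {y} x<y
    with archimedean ((y - x) ⁻¹)
  ... | k , d⁻¹<k
    with archimedean (- (fromℕ (suc k) * x))
  ... | m , -cx<m
    with archimedean (fromℕ (suc k) * x + fromℕ m)
  ... | n , u<n
    with ceiling n (<⇒≤ (<-respʳ-≈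
      (solve 2 (λ c m → m :- (:- c) := c :+ m) refl (fromℕ (suc k) * x) (fromℕ m)) (0<y-x -cx<m))) u<n
  ... | j , u<j , j≤1+u = j , m , k , *-cancelˡ-< 0<c x<q , *-cancelˡ-< 0<c q<y
    where
    c = fromℕ (suc k)
    d = y - x
    0<c : 0# < c
    0<c = 0<fromℕ (suc k)
    cq : c * fraction j m k ≈ fromℕ j - fromℕ m
    cq = begin-equality
      c * ((fromℕ j - fromℕ m) * c ⁻¹)
        ≈⟨ solve 3 (λ c a i → c :* (a :* i) := a :* (c :* i)) refl c (fromℕ j - fromℕ m) (c ⁻¹) ⟩
      (fromℕ j - fromℕ m) * (c * c ⁻¹) ≈⟨ *-congˡ (*-inverseʳ (pos⇒≉0 0<c)) ⟩
      (fromℕ j - fromℕ m) * 1#         ≈⟨ *-identityʳ _ ⟩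
      fromℕ j - fromℕ m                ∎
    1<dc : 1# < d * c
    1<dc = begin-strict
      1#            ≈⟨ *-inverseʳ (pos⇒≉0 (0<y-x x<y)) ⟨
      d * d ⁻¹      <⟨ *-monoˡ-< (0<y-x x<y) d⁻¹<k ⟩
      d * fromℕ k
        ≤⟨ *-monoˡ-≤ (<⇒≤ (0<y-x x<y)) (≤-by 0≤1 (solve 2 (λ o k → o := o :+ k :- k) refl 1# (fromℕ k))) ⟩
      d * c         ∎
    x<q : c * x < c * fraction j m k
    x<q = <-respʳ-≈ (sym cq) (<-by (0<y-x u<j)
      (solve 3 (λ cx m j → j :- (cx :+ m) := (j :- m) :- cx) refl (c * x) (fromℕ m) (fromℕ j)))
    q<y : c * fraction j m k < c * y
    q<y = begin-strict
      c * fraction j m k                       ≈⟨ cq ⟩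
      fromℕ j - fromℕ m                        ≤⟨ +-monoˡ-≤ (- fromℕ m) j≤1+u ⟩
      c * x + fromℕ m + 1# - fromℕ m           <⟨ <-by (0<y-x 1<dc) (solve 5
        (λ c x y m o → (y :- x) :* c :- o := c :* y :- (c :* x :+ m :+ o :- m)) refl c x y (fromℕ m) 1#) ⟩
      c * y                                    ∎

-- Null sequences and uniqueness of limits.

module Limit (𝓡 : RealNumbers) where
  open RealNumbers 𝓡
  open OrderedField 𝓡
  open Archimedean 𝓡
  open ≤-Reasoning

  private variable
    c l m u v x y : ℝ
    a b : ℕ → ℝ

  0<2 : 0# < 1# + 1#
  0<2 = 0<x+y 0<1 0≤1

  half : ℝ → ℝ
  half x = x / (1# + 1#)

  half+half : ∀ x → half x + half x ≈ x
  half+half x = begin-equality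
    half x + half x
      ≈⟨ solve 2 (λ x i → x :* i :+ x :* i := x :* (con (+ 2) :* i)) refl x ((1# + 1#) ⁻¹) ⟩
    x * ((1# + 1#) * (1# + 1#) ⁻¹)       ≈⟨ *-congˡ (*-inverseʳ (pos⇒≉0 0<2)) ⟩
    x * 1#                               ≈⟨ *-identityʳ x ⟩
    x                                    ∎

  0<half : 0# < x → 0# < half x
  0<half 0<x = 0<x*y 0<x (0<x⁻¹ 0<2)

  infix 4 _⊑_
  -- ∣ x ∣ ≤ u
  _⊑_ : ℝ → ℝ → Set
  x ⊑ u = - u ≤ x × x ≤ u

  ⊑-resp-≈ : x ≈ y → x ⊑ u → y ⊑ u
  ⊑-resp-≈ x≈y (l , r) = ≤-respʳ-≈ x≈y l , ≤-respˡ-≈ x≈y r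

  ⊑-respʳ-≈ : u ≈ v → x ⊑ u → x ⊑ v
  ⊑-respʳ-≈ u≈v (l , r) = ≤-respˡ-≈ (-‿cong u≈v) l , ≤-respʳ-≈ u≈v r

  0≤⇒⊑ : 0# ≤ x → x ⊑ x
  0≤⇒⊑ {x} 0≤x =
    ≤-trans (≤-by 0≤x (solve 1 (λ x → x := con (+ 0) :- (:- x)) refl x)) 0≤x , ≤-refl

  ⊑-≤-trans : x ⊑ u → u ≤ v → x ⊑ v
  ⊑-≤-trans {u = u} {v} (l , r) u≤v =
    ≤-trans (≤-by (0≤y-x u≤v) (solve 2 (λ u v → v :- u := :- u :- :- v) refl u v)) l ,
    ≤-trans r u≤v

  ⊑-neg : x ⊑ u → - x ⊑ u
  ⊑-neg {x} {u} (l , r) =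
    ≤-by (0≤y-x r) (solve 2 (λ u x → u :- x := (:- x) :- (:- u)) refl u x) ,
    ≤-by (0≤y-x l) (solve 2 (λ u x → x :- :- u := u :- :- x) refl u x)

  ⊑-+ : x ⊑ u → y ⊑ v → x + y ⊑ u + v
  ⊑-+ {u = u} {v = v} (l , r) (l′ , r′) =
    ≤-respˡ-≈ (solve 2 (λ u v → :- u :+ :- v := :- (u :+ v)) refl u v) (+-mono-≤ l l′) ,
    +-mono-≤ r r′

  -- Adding (u - x)(y + v) ≥ 0 and (x + u)(v - y) ≥ 0 gives 2 x y ≤ 2 u v with no case distinction
  -- on signs; the lower bound is the same estimate for - x.
  ⊑-* : x ⊑ u → y ⊑ v → x * y ⊑ u * v
  ⊑-* {x} {u} {y} {v} p q =
    ≤-by (0≤y-x (upper (⊑-neg p) q)) (solve 4 (λ x y u v → u :* v :- (:- x) :* y := x :* y :- (:- (u :* v)))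
      refl x y u v) ,
    upper p q
    where
    upper : ∀ {x u y v} → x ⊑ u → y ⊑ v → x * y ≤ u * v
    upper {x} {u} {y} {v} (l , r) (l′ , r′) = *-cancelˡ-≤ 0<2 (≤-by
      (0≤x+y (*-nonNegative (0≤y-x r) (0≤y-x l′)) (*-nonNegative (0≤y-x l) (0≤y-x r′)))
      (solve 4 (λ x y u v → (u :- x) :* (y :- :- v) :+ (x :- :- u) :* (v :- y)
                          := con (+ 2) :* (u :* v) :- con (+ 2) :* (x :* y)) refl x y u v))

  -- The bound is made strictly positive because `null-*ˡ` divides by it.
  bound : ∀ x → ∃ λ u → 0# < u × x ⊑ u
  bound x with total 0# x
  ... | inj₁ 0≤x = x + 1# , ≤-<-1 0≤x , ⊑-≤-trans (0≤⇒⊑ 0≤x) (<⇒≤ x<x+1)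
    where
    ≤-<-1 : 0# ≤ x → 0# < x + 1#
    ≤-<-1 0≤x = begin-strict 0# ≤⟨ 0≤x ⟩ x <⟨ x<x+1 ⟩ x + 1# ∎
  ... | inj₂ x≤0 = 1# - x , 0<x+y 0<1 0≤-x ,
    ⊑-resp-≈ (solve 1 (λ x → :- :- x := x) refl x)
      (⊑-neg (⊑-≤-trans (0≤⇒⊑ 0≤-x) (≤-by 0≤1 (solve 2 (λ o x → o := (o :- x) :- :- x) refl 1# x))))
    where
    0≤-x : 0# ≤ - x
    0≤-x = ≤-by (0≤y-x x≤0) (solve 1 (λ x → con (+ 0) :- x := (:- x) :- con (+ 0)) refl x)

  -- The bounds are non-strict, unlike those in `_⟶_`, so that they combine directly by `⊑-+` and
  -- `⊑-*`.
  Null : (ℕ → ℝ) → Set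
  Null a = ∀ ε → 0# < ε → ∃ λ N → ∀ n → N ℕ.≤ n → a n ⊑ ε

  null-cong : (∀ n → a n ≈ b n) → Null a → Null b
  null-cong a≈b null ε 0<ε with null ε 0<ε
  ... | N , p = N , λ n N≤n → ⊑-resp-≈ (a≈b n) (p n N≤n)

  null-⊑ : (∀ n → a n ⊑ b n) → Null b → Null a
  null-⊑ a⊑b null ε 0<ε with null ε 0<ε
  ... | N , p = N , λ n N≤n → ⊑-≤-trans (a⊑b n) (proj₂ (p n N≤n))

  null-∘ : (f : ℕ → ℕ) → (∀ n → n ℕ.≤ f n) → Null a → Null (λ n → a (f n))
  null-∘ f n≤fn null ε 0<ε with null ε 0<ε
  ... | N , p = N , λ n N≤n → p (f n) (ℕ.≤-trans N≤n (n≤fn n))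

  null-neg : Null a → Null (λ n → - a n)
  null-neg null ε 0<ε with null ε 0<ε
  ... | N , p = N , λ n N≤n → ⊑-neg (p n N≤n)

  null-+ : Null a → Null b → Null (λ n → a n + b n)
  null-+ null null′ ε 0<ε with null (half ε) (0<half 0<ε) | null′ (half ε) (0<half 0<ε)
  ... | N , p | N′ , p′ = N ℕ.⊔ N′ , λ n N⊔N′≤n → ⊑-respʳ-≈ (half+half ε)
    (⊑-+ (p n (ℕ.m⊔n≤o⇒m≤o N N′ N⊔N′≤n)) (p′ n (ℕ.m⊔n≤o⇒n≤o N N′ N⊔N′≤n)))

  null-*ˡ : ∀ x → Null a → Null (λ n → x * a n)
  null-*ˡ x null ε 0<ε with bound x
  ... | u , 0<u , x⊑u with null (ε / u) (0<x*y 0<ε (0<x⁻¹ 0<u))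
  ... | N , p = N , λ n N≤n → ⊑-respʳ-≈ u*[ε/u]≈ε (⊑-* x⊑u (p n N≤n))
    where
    u*[ε/u]≈ε : u * (ε / u) ≈ ε
    u*[ε/u]≈ε = begin-equality
      u * (ε * u ⁻¹)  ≈⟨ solve 3 (λ u e i → u :* (e :* i) := e :* (u :* i)) refl u ε (u ⁻¹) ⟩
      ε * (u * u ⁻¹)  ≈⟨ *-congˡ (*-inverseʳ (pos⇒≉0 0<u)) ⟩
      ε * 1#          ≈⟨ *-identityʳ ε ⟩
      ε               ∎

  null-* : Null a → Null b → Null (λ n → a n * b n)
  -- For the second factor it is enough to be eventually bounded by 1.
  null-* null null′ ε 0<ε with null ε 0<ε | null′ 1# 0<1
  ... | N , p | N′ , p′ = N ℕ.⊔ N′ , λ n N⊔N′≤n → ⊑-respʳ-≈ (*-identityʳ ε)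
    (⊑-* (p n (ℕ.m⊔n≤o⇒m≤o N N′ N⊔N′≤n)) (p′ n (ℕ.m⊔n≤o⇒n≤o N N′ N⊔N′≤n)))

  null-const : Null (λ _ → x) → x ≈ 0#
  null-const {x} null = antisym (nonPositive null)
    (≤-by (0≤y-x (nonPositive (null-neg null)))
      (solve 1 (λ x → con (+ 0) :- :- x := x :- con (+ 0)) refl x))
    where
    nonPositive : ∀ {x} → Null (λ _ → x) → x ≤ 0#
    nonPositive {x} null with x ≤? 0#
    ... | yes x≤0 = x≤0
    ... | no  x≰0 with null (half x) (0<half (≰⇒> x≰0))
    ... | N , p = contradiction (proj₂ (p N ℕ.≤-refl)) (<⇒≱ (<-by (0<half (≰⇒> x≰0)) (begin-equality
      half x                     ≈⟨ solve 1 (λ h → h := h :+ h :- h) refl (half x) ⟩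
      half x + half x - half x   ≈⟨ +-congʳ (half+half x) ⟩
      x - half x                 ∎)))

  ⟶⇒null : a ⟶ l → Null (λ n → a n - l)
  ⟶⇒null {a} {l} a⟶l ε 0<ε with a⟶l ε 0<ε
  ... | N , p = N , λ n N≤n →
    ≤-by (0≤y-x (<⇒≤ (proj₁ (p n N≤n)))) (solve 3 (λ a l e → a :- (l :- e) := a :- l :- :- e)
      refl (a n) l ε) ,
    ≤-by (0≤y-x (<⇒≤ (proj₂ (p n N≤n)))) (solve 3 (λ a l e → l :+ e :- a := e :- (a :- l)) refl (a n) l ε)

  ⟶-unique : a ⟶ l → b ⟶ m → (∀ n → a n ≈ b n) → l ≈ m
  ⟶-unique {a} {l} {b} {m} a⟶l b⟶m a≈b = begin-equality
    l            ≈⟨ solve 2 (λ l m → l := l :- m :+ m) refl l m ⟩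
    l - m + m    ≈⟨ +-congʳ (null-const (null-cong l-m (null-+ (null-neg (⟶⇒null a⟶l)) (⟶⇒null b⟶m)))) ⟩
    0# + m       ≈⟨ +-identityˡ m ⟩
    m            ∎
    where
    l-m : ∀ n → - (a n - l) + (b n - m) ≈ l - m
    l-m n = begin-equality
      - (a n - l) + (b n - m)  ≈⟨ +-congʳ (-‿cong (+-congʳ (a≈b n))) ⟩
      - (b n - l) + (b n - m)  ≈⟨ solve 3 (λ b l m → :- (b :- l) :+ (b :- m) := l :- m) refl (b n) l m ⟩
      l - m                    ∎

  eventually-const⟶ : ∀ N → (∀ n → a (N ℕ.+ n) ≈ l) → a ⟶ l
  eventually-const⟶ {a} {l} N a≈l ε 0<ε = N , λ n N≤n →
    let an≈l : a n ≈ l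
        an≈l = trans (reflexive (≡.cong a (≡.sym (ℕ.m+[n∸m]≡n N≤n)))) (a≈l (n ℕ.∸ N))
    in <-respʳ-≈ (sym an≈l) (<-by 0<ε (solve 2 (λ l e → e := l :- (l :- e)) refl l ε)) ,
       <-respˡ-≈ (sym an≈l) (<-by 0<ε (solve 2 (λ l e → e := l :+ e :- l) refl l ε))

  ⟶-≥ : ∀ N → (∀ n → c ≤ a (N ℕ.+ n)) → a ⟶ l → c ≤ l
  ⟶-≥ {c} {a} {l} N c≤a a⟶l with c ≤? l
  ... | yes c≤l = c≤l
  ... | no  c≰l with a⟶l (c - l) (0<y-x (≰⇒> c≰l))
  ... | M , p = contradiction (c≤a M)
    (<⇒≱ (<-respʳ-≈ (solve 2 (λ c l → l :+ (c :- l) := c) refl c l) (proj₂ (p (N ℕ.+ M) (ℕ.m≤n+m M N)))))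

-- Double sums over squares, triangles and diagonals.

module PartialSums (𝓡 : RealNumbers) where
  open RealNumbers 𝓡
  open OrderedField 𝓡
  open Limit 𝓡
  open SemiringSum semiring using (sum-cong-≋; ∑-distrib-+; *-distribˡ-sum; *-distribʳ-sum)
  open ≤-Reasoning

  private variable f f′ g g′ : ℕ → ℝ

  sum-mono : ∀ {n} {x y : Fin n → ℝ} → (∀ i → x i ≤ y i) → sum x ≤ sum y
  sum-mono {zero}  x≤y = ≤-refl
  sum-mono {suc n} x≤y = +-mono-≤ (x≤y Fin.zero) (sum-mono (λ i → x≤y (Fin.suc i)))

  partialSum-nonNeg : ∀ n → (∀ i → 0# ≤ f i) → 0# ≤ partialSum f n
  partialSum-nonNeg zero    0≤f = ≤-refl
  partialSum-nonNeg (suc n) 0≤f = 0≤x+y (0≤f 0) (partialSum-nonNeg n (λ i → 0≤f (suc i)))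

  partialSum-monoʳ : ∀ {m n} → (∀ i → 0# ≤ f i) → m ℕ.≤ n → partialSum f m ≤ partialSum f n
  partialSum-monoʳ {n = n} 0≤f ℕ.z≤n       = partialSum-nonNeg n 0≤f
  partialSum-monoʳ         0≤f (ℕ.s≤s m≤n) =
    +-mono-≤ ≤-refl (partialSum-monoʳ (λ i → 0≤f (suc i)) m≤n)

  partialSum-⊑ : ∀ n → (∀ i → f i ⊑ g i) → partialSum f n ⊑ partialSum g n
  partialSum-⊑ zero    f⊑g = 0≤⇒⊑ ≤-refl
  partialSum-⊑ (suc n) f⊑g = ⊑-+ (f⊑g 0) (partialSum-⊑ n (λ i → f⊑g (suc i)))

  partialSum-tail-⊑ : ∀ {m n} → m ℕ.≤ n → (∀ i → f i ⊑ g i) →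
                      partialSum f n - partialSum f m ⊑ partialSum g n - partialSum g m
  partialSum-tail-⊑ {f} {g} {n = n} ℕ.z≤n f⊑g =
    ⊑-resp-≈ (x≈x-0 (partialSum f n)) (⊑-respʳ-≈ (x≈x-0 (partialSum g n)) (partialSum-⊑ n f⊑g))
    where
    x≈x-0 : ∀ x → x ≈ x - 0#
    x≈x-0 = solve 1 (λ x → x := x :- con (+ 0)) refl
  partialSum-tail-⊑ {f} {g} (ℕ.s≤s {m} {n} m≤n) f⊑g =
    ⊑-resp-≈ (cancel (f 0) _ _) (⊑-respʳ-≈ (cancel (g 0) _ _)
      (partialSum-tail-⊑ m≤n (λ i → f⊑g (suc i))))
    where
    cancel : ∀ c x y → x - y ≈ (c + x) - (c + y)
    cancel = solve 3 (λ c x y → x :- y := (c :+ x) :- (c :+ y)) refl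

  partialSum-diff-⊑ : ∀ n → (∀ i → f i - g i ⊑ f′ i - g′ i) →
                      partialSum f n - partialSum g n ⊑ partialSum f′ n - partialSum g′ n
  partialSum-diff-⊑ zero    _ = 0≤⇒⊑ (0≤y-x ≤-refl)
  partialSum-diff-⊑ {f} {g} {f′} {g′} (suc n) d =
    ⊑-resp-≈ (interchange (f 0) (g 0) _ _) (⊑-respʳ-≈ (interchange (f′ 0) (g′ 0) _ _)
      (⊑-+ (d 0) (partialSum-diff-⊑ n (λ i → d (suc i)))))
    where
    interchange : ∀ a b x y → (a - b) + (x - y) ≈ (a + x) - (b + y)
    interchange = solve 4 (λ a b x y → (a :- b) :+ (x :- y) := (a :+ x) :- (b :+ y)) refl

  -- The triangle consists of the pairs with i + j < n, the diagonal of those with i + j = n; the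
  -- latter is the shape of the binomial expansion.
  squareSum triangleSum diagonal : (ℕ → ℕ → ℝ) → ℕ → ℝ
  squareSum   t n = partialSum (λ i → partialSum (t i) n) n
  triangleSum t n = partialSum (λ i → partialSum (t i) (n ∸ i)) n
  diagonal    t n = partialSum (λ i → t i (n ∸ i)) (suc n)

  -- The induction removes row 0: every diagonal after the first loses its first entry and becomes
  -- the preceding diagonal of the shifted array `t′`.
  triangle-by-diagonals : ∀ t n → partialSum (diagonal t) n ≈ triangleSum t n
  triangle-by-diagonals t zero    = refl
  triangle-by-diagonals t (suc n) = begin-equality
    (t 0 0 + 0#) + partialSum (λ k → t 0 (suc k) + diagonal t′ k) n
      ≈⟨ +-cong (+-identityʳ _) (∑-distrib-+ {n} (λ k → t 0 (suc (toℕ k))) (λ k → diagonal t′ (toℕ k))) ⟩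
    t 0 0 + (partialSum (λ k → t 0 (suc k)) n + partialSum (diagonal t′) n)
      ≈⟨ +-assoc _ _ _ ⟨
    t 0 0 + partialSum (λ k → t 0 (suc k)) n + partialSum (diagonal t′) n
      ≈⟨ +-congˡ (triangle-by-diagonals t′ n) ⟩
    t 0 0 + partialSum (λ k → t 0 (suc k)) n + triangleSum t′ n
      ∎
    where t′ = λ i → t (suc i)

  product-squareSum : ∀ f g n → partialSum f n * partialSum g n ≈ squareSum (λ i j → f i * g j) n
  product-squareSum f g n = trans (*-distribʳ-sum {n} (partialSum g n) (λ i → f (toℕ i)))
    (sum-cong-≋ {n} (λ i → *-distribˡ-sum {n} (f (toℕ i)) (λ j → g (toℕ j))))

  -- In each row, what the square has beyond the triangle is the stretch from n - i to n, and
  -- domination of the entries passes to such stretches.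
  corner-⊑ : ∀ {s t} n → (∀ i j → t i j ⊑ s i j) →
             squareSum t n - triangleSum t n ⊑ squareSum s n - triangleSum s n
  corner-⊑ n t⊑s = partialSum-diff-⊑ n (λ i → partialSum-tail-⊑ (ℕ.m∸n≤m n i) (t⊑s i))

  -- From i, j < n follows i + j < 2 n: row i of the large triangle has length 2 n - i, which is at
  -- least n.
  squareSum≤triangleSum : ∀ {s} n → (∀ i j → 0# ≤ s i j) → squareSum s n ≤ triangleSum s (n ℕ.+ n)
  squareSum≤triangleSum {s} n 0≤s = ≤-trans
    (sum-mono {n} (λ i → partialSum-monoʳ (0≤s (toℕ i)) (n≤n+n∸i (ℕ.<⇒≤ (Fin.toℕ<n i)))))
    (partialSum-monoʳ (λ i → partialSum-nonNeg (n ℕ.+ n ∸ i) (0≤s i)) (ℕ.m≤m+n n n))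
    where
    n≤n+n∸i : ∀ {i} → i ℕ.≤ n → n ℕ.≤ n ℕ.+ n ∸ i
    n≤n+n∸i {i} i≤n = ≡.subst (n ℕ.≤_) (≡.sym (ℕ.+-∸-assoc n i≤n)) (ℕ.m≤m+n n (n ∸ i))

-- The functional equation and monotonicity of the exponential.

module Exponential (𝓡 : RealNumbers) (𝓔 : ExpLog 𝓡) where
  open RealNumbers 𝓡
  open ExpLog 𝓔
  open OrderedField 𝓡
  open Archimedean 𝓡
  open Limit 𝓡
  open PartialSums 𝓡
  open SemiringSum semiring using (sum-cong-≋; *-distribʳ-sum)
  open SemiringExp semiring using (^-congˡ)
  open SemiringMult semiring using (×1-homo-*; ×-assoc-*) renaming (×-congʳ to ·-congʳ)
  open ≤-Reasoning

  private variable u v x y : ℝ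

  term : ℝ → ℕ → ℝ
  term x k = x ^ k / fromℕ (k !)

  0<k! : ∀ k → 0# < fromℕ (k !)
  0<k! k = 0<fromℕ (k !) {{k ℕ.!≢0}}

  k!≉0 : ∀ k → fromℕ (k !) ≉ 0#
  k!≉0 k = pos⇒≉0 (0<k! k)

  ^-⊑ : ∀ k → x ⊑ u → x ^ k ⊑ u ^ k
  ^-⊑ zero    x⊑u = 0≤⇒⊑ 0≤1
  ^-⊑ (suc k) x⊑u = ⊑-* x⊑u (^-⊑ k x⊑u)

  0≤x^k : ∀ k → 0# ≤ x → 0# ≤ x ^ k
  0≤x^k zero    0≤x = 0≤1
  0≤x^k (suc k) 0≤x = *-nonNegative 0≤x (0≤x^k k 0≤x)

  0≤term : ∀ k → 0# ≤ x → 0# ≤ term x k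
  0≤term k 0≤x = *-nonNegative (0≤x^k k 0≤x) (<⇒≤ (0<x⁻¹ (0<k! k)))

  term-⊑ : ∀ k → x ⊑ u → term x k ⊑ term u k
  term-⊑ k x⊑u = ⊑-* (^-⊑ k x⊑u) (0≤⇒⊑ (<⇒≤ (0<x⁻¹ (0<k! k))))

  /-factor : ∀ {a b c d} → a ≉ 0# → c ≉ 0# → d ≉ 0# → a ≈ b * (c * d) → b / a ≈ c ⁻¹ * d ⁻¹
  /-factor {a} {b} {c} {d} a≉0 c≉0 d≉0 a≈bcd = *-cancelˡ a≉0 (begin-equality
    a * (b * a ⁻¹)              ≈⟨ solve 3 (λ a b i → a :* (b :* i) := b :* (a :* i)) refl a b (a ⁻¹) ⟩
    b * (a * a ⁻¹)              ≈⟨ *-congˡ (*-inverseʳ a≉0) ⟩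
    b * 1#
      ≈⟨ *-congˡ (trans (*-cong (*-inverseʳ c≉0) (*-inverseʳ d≉0)) (*-identityˡ 1#)) ⟨
    b * (c * c ⁻¹ * (d * d ⁻¹))
      ≈⟨ solve 5 (λ b c d i j → b :* (c :* i :* (d :* j)) := b :* (c :* d) :* (i :* j))
        refl b c d (c ⁻¹) (d ⁻¹) ⟩
    b * (c * d) * (c ⁻¹ * d ⁻¹) ≈⟨ *-congʳ a≈bcd ⟨
    a * (c ⁻¹ * d ⁻¹)           ∎)

  n!≈nCk*k!*[n∸k]! : ∀ {n k} → k ℕ.≤ n →
                     fromℕ (n !) ≈ fromℕ (n choose k) * (fromℕ (k !) * fromℕ ((n ∸ k) !))
  n!≈nCk*k!*[n∸k]! {n} {k} k≤n = begin-equality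
    fromℕ (n !)                                           ≡⟨ ≡.cong fromℕ n!≡ ⟩
    fromℕ ((n choose k) ℕ.* (k ! ℕ.* (n ∸ k) !))               ≈⟨ ×1-homo-* (n choose k) _ ⟩
    fromℕ (n choose k) * fromℕ (k ! ℕ.* (n ∸ k) !)             ≈⟨ *-congˡ (×1-homo-* (k !) ((n ∸ k) !)) ⟩
    fromℕ (n choose k) * (fromℕ (k !) * fromℕ ((n ∸ k) !))     ∎
    where
    instance
      nonZero : ℕ.NonZero (k ! ℕ.* (n ∸ k) !)
      nonZero = k ℕ.!* (n ∸ k) !≢0
    n!≡ : n ! ≡ (n choose k) ℕ.* (k ! ℕ.* (n ∸ k) !)
    n!≡ = ≡.sym (≡.trans (≡.cong (ℕ._* (k ! ℕ.* (n ∸ k) !)) (nCk≡n!/k![n-k]! k≤n)) (m/n*n≡m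
      (k![n∸k]!∣n! k≤n)))

  term-+ : ∀ x y n → term (x + y) n ≈ diagonal (λ i j → term x i * term y j) n
  term-+ x y n = begin-equality
    (x + y) ^ n / fromℕ (n !)
      ≈⟨ *-congʳ (Binomial.theorem (CommutativeRing.commutativeSemiring commutativeRing) n x y) ⟩
    sum {suc n} (λ k → (n choose toℕ k) · (x ^ toℕ k * y ^ (n ∸ toℕ k))) / fromℕ (n !)
      ≈⟨ *-distribʳ-sum {suc n} _ (λ k → (n choose toℕ k) · (x ^ toℕ k * y ^ (n ∸ toℕ k))) ⟩
    sum {suc n} (λ k → (n choose toℕ k) · (x ^ toℕ k * y ^ (n ∸ toℕ k)) / fromℕ (n !))
      ≈⟨ sum-cong-≋ {suc n} (λ k → split (toℕ k) (ℕ.s≤s⁻¹ (Fin.toℕ<n k))) ⟩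
    diagonal (λ i j → term x i * term y j) n ∎
    where
    split : ∀ k → k ℕ.≤ n → (n choose k) · (x ^ k * y ^ (n ∸ k)) / fromℕ (n !) ≈ term x k * term y (n ∸ k)
    split k k≤n = begin-equality
      (n choose k) · z / fromℕ (n !)
        ≈⟨ *-congʳ (trans (×-assoc-* (n choose k) 1# z) (·-congʳ (n choose k) (*-identityˡ z))) ⟨
      fromℕ (n choose k) * z / fromℕ (n !)
        ≈⟨ solve 3 (λ c z i → c :* z :* i := z :* (c :* i)) refl (fromℕ (n choose k)) z _ ⟩
      z * (fromℕ (n choose k) / fromℕ (n !))
        ≈⟨ *-congˡ (/-factor (k!≉0 n) (k!≉0 k) (k!≉0 (n ∸ k)) (n!≈nCk*k!*[n∸k]! k≤n)) ⟩
      x ^ k * y ^ (n ∸ k) * (fromℕ (k !) ⁻¹ * fromℕ ((n ∸ k) !) ⁻¹)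
        ≈⟨ solve 4 (λ a b i j → a :* b :* (i :* j) := a :* i :* (b :* j)) refl (x ^ k) (y ^ (n ∸ k)) _ _ ⟩
      term x k * term y (n ∸ k) ∎
      where
      z = x ^ k * y ^ (n ∸ k)

  partialSum-term-+ : ∀ x y n → partialSum (term (x + y)) n ≈ triangleSum (λ i j → term x i * term y j) n
  partialSum-term-+ x y n = trans (sum-cong-≋ {n} (λ k → term-+ x y (toℕ k)))
    (triangle-by-diagonals (λ i j → term x i * term y j) n)

  partialSum-term-*-⊑ : 0# ≤ u → x ⊑ u → 0# ≤ v → y ⊑ v → ∀ n →
    partialSum (term x) n * partialSum (term y) n - partialSum (term (x + y)) n ⊑
    partialSum (term (u + v)) (n ℕ.+ n) - partialSum (term (u + v)) n
  partialSum-term-*-⊑ {u} {x} {v} {y} 0≤u x⊑u 0≤v y⊑v n =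
    ⊑-resp-≈ (sym (+-cong (product-squareSum (term x) (term y) n) (-‿cong (partialSum-term-+ x y n))))
      (⊑-respʳ-≈ (sym (+-cong (partialSum-term-+ u v (n ℕ.+ n)) (-‿cong (partialSum-term-+ u v n))))
        (⊑-≤-trans (corner-⊑ n (λ i j → ⊑-* (term-⊑ i x⊑u) (term-⊑ j y⊑v)))
          (+-monoˡ-≤ _ (squareSum≤triangleSum n (λ i j → *-nonNegative (0≤term i 0≤u) (0≤term j 0≤v))))))

  -- The constant l m - exp (x + y) is written as a combination of null sequences, by way of a b - l
  -- m = m (a - l) + l (b - m) + (a - l)(b - m); a constant null sequence is 0. The error a b - c is
  -- dominated by d (2 n) - d n, which is null because d converges.
  exp-+ : ∀ x y → exp (x + y) ≈ exp x * exp y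
  exp-+ x y with bound x | bound y
  ... | u , 0<u , x⊑u | v , 0<v , y⊑v = sym (begin-equality
    l * m                    ≈⟨ solve 2 (λ a b → a := a :- b :+ b) refl (l * m) (exp (x + y)) ⟩
    l * m - exp (x + y) + exp (x + y)
                             ≈⟨ +-congʳ (null-const (null-cong rearrange
                                  (null-+ (null-+ product-error (null-neg factor-error)) (⟶⇒null (exp-series
                                    (x + y)))))) ⟩
    0# + exp (x + y)         ≈⟨ +-identityˡ _ ⟩
    exp (x + y)              ∎)
    where
    l = exp x
    m = exp y
    a b c d : ℕ → ℝ
    a = partialSum (term x)
    b = partialSum (term y)
    c = partialSum (term (x + y))
    d = partialSum (term (u + v))

    cauchy : ∀ n → (d (n ℕ.+ n) - exp (u + v)) - (d n - exp (u + v)) ≈ d (n ℕ.+ n) - d n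
    cauchy n = solve 3 (λ x y e → (x :- e) :- (y :- e) := x :- y) refl (d (n ℕ.+ n)) (d n) (exp (u + v))

    product-error : Null (λ n → a n * b n - c n)
    product-error = null-⊑ (partialSum-term-*-⊑ (<⇒≤ 0<u) x⊑u (<⇒≤ 0<v) y⊑v)
      (null-cong cauchy (null-+ (null-∘ (λ n → n ℕ.+ n) (λ n → ℕ.m≤m+n n n) (⟶⇒null (exp-series (u + v))))
                                (null-neg (⟶⇒null (exp-series (u + v))))))

    factor-error : Null (λ n → m * (a n - l) + l * (b n - m) + (a n - l) * (b n - m))
    factor-error = null-+ (null-+ (null-*ˡ m (⟶⇒null (exp-series x))) (null-*ˡ l (⟶⇒null (exp-series y))))
                          (null-* (⟶⇒null (exp-series x)) (⟶⇒null (exp-series y)))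

    rearrange : ∀ n → (a n * b n - c n) - (m * (a n - l) + l * (b n - m) + (a n - l) * (b n - m)) +
      (c n - exp (x + y))
                      ≈ l * m - exp (x + y)
    rearrange n = solve 6 (λ a b c l m e →
        (a :* b :- c) :- (m :* (a :- l) :+ l :* (b :- m) :+ (a :- l) :* (b :- m)) :+ (c :- e)
          := l :* m :- e)
      refl (a n) (b n) (c n) l m (exp (x + y))

  -- The field `exp` is a bare function on a setoid. It respects `_≈_` because equal arguments have
  -- termwise equal series, and limits are unique.
  exp-cong : x ≈ y → exp x ≈ exp y
  exp-cong {x} {y} x≈y = ⟶-unique (exp-series x) (exp-series y)
    (λ n → sum-cong-≋ {n} (λ k → *-congʳ (^-congˡ (toℕ k) x≈y)))

  -- The remaining terms of the series are nonnegative. Positivity and strict monotonicity of `exp`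
  -- rest on this estimate.
  1+x≤exp : 0# ≤ x → 1# + x ≤ exp x
  1+x≤exp {x} 0≤x = ⟶-≥ 2 1+x≤partialSum (exp-series x)
    where
    -- The denominators 0! and 1! become `1# + 0#`, and the axioms do not state that `_⁻¹` respects
    -- `_≈_`.
    1⁻¹≈1 : ∀ {y} → y ≈ 1# → y ⁻¹ ≈ 1#
    1⁻¹≈1 {y} y≈1 = begin-equality
      y ⁻¹       ≈⟨ *-identityˡ _ ⟨
      1# * y ⁻¹  ≈⟨ *-congʳ y≈1 ⟨
      y * y ⁻¹   ≈⟨ *-inverseʳ (λ y≈0 → 0≉1 (trans (sym y≈0) y≈1)) ⟩
      1#         ∎
    1+x≤partialSum : ∀ n → 1# + x ≤ partialSum (term x) (2 ℕ.+ n)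
    1+x≤partialSum n = begin
      1# + x                                  ≈⟨ +-cong (trans (*-identityˡ _) (1⁻¹≈1 (+-identityʳ 1#)))
                                                        (trans (*-cong (*-identityʳ x) (1⁻¹≈1
                                                          (+-identityʳ 1#))) (*-identityʳ x)) ⟨
      term x 0 + term x 1                     ≈⟨ +-congˡ (+-identityʳ _) ⟨
      term x 0 + (term x 1 + 0#)
        ≤⟨ +-mono-≤ ≤-refl (+-mono-≤ ≤-refl (partialSum-nonNeg n (λ k → 0≤term (2 ℕ.+ k) 0≤x))) ⟩
      partialSum (term x) (2 ℕ.+ n)           ∎

  exp-0 : exp 0# ≈ 1#
  exp-0 = *-cancelˡ (pos⇒≉0 0<exp0) (begin-equality
    exp 0# * exp 0#  ≈⟨ exp-+ 0# 0# ⟨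
    exp (0# + 0#)    ≈⟨ exp-cong (+-identityˡ 0#) ⟩
    exp 0#           ≈⟨ *-identityʳ _ ⟨
    exp 0# * 1#      ∎)
    where
    0<exp0 : 0# < exp 0#
    0<exp0 = begin-strict 0# <⟨ 0<1 ⟩ 1# ≈⟨ +-identityʳ 1# ⟨ 1# + 0# ≤⟨ 1+x≤exp ≤-refl ⟩ exp 0# ∎

  exp-inverse : ∀ x → exp x * exp (- x) ≈ 1#
  exp-inverse x = trans (sym (exp-+ x (- x))) (trans (exp-cong (-‿inverseʳ x)) exp-0)

  1≤exp : 0# ≤ x → 1# ≤ exp x
  1≤exp {x} 0≤x = begin
    1#      ≤⟨ ≤-by 0≤x (solve 2 (λ o x → x := o :+ x :- o) refl 1# x) ⟩
    1# + x  ≤⟨ 1+x≤exp 0≤x ⟩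
    exp x   ∎

  0<exp : ∀ x → 0# < exp x
  0<exp x with 0# ≤? x
  ... | yes 0≤x = begin-strict 0# <⟨ 0<1 ⟩ 1# ≤⟨ 1≤exp 0≤x ⟩ exp x ∎
  ... | no  0≰x = *-cancelˡ-< 0<exp[-x] (begin-strict
    exp (- x) * 0#     ≈⟨ zeroʳ _ ⟩
    0#                 <⟨ 0<1 ⟩
    1#                 ≈⟨ exp-inverse x ⟨
    exp x * exp (- x)  ≈⟨ *-comm _ _ ⟩
    exp (- x) * exp x  ∎)
    where
    0≤-x : 0# ≤ - x
    0≤-x = ≤-by (0≤y-x (<⇒≤ (≰⇒> 0≰x))) (solve 1 (λ x → con (+ 0) :- x := (:- x) :- con (+ 0)) refl x)
    0<exp[-x] : 0# < exp (- x)
    0<exp[-x] = begin-strict 0# <⟨ 0<1 ⟩ 1# ≤⟨ 1≤exp 0≤-x ⟩ exp (- x) ∎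

  exp-split : ∀ x y → exp y ≈ exp x * exp (y - x)
  exp-split x y = trans (exp-cong (solve 2 (λ x y → y := x :+ (y :- x)) refl x y)) (exp-+ x (y - x))

  exp-mono-< : x < y → exp x < exp y
  exp-mono-< {x} {y} x<y = begin-strict
    exp x                 ≈⟨ *-identityʳ _ ⟨
    exp x * 1#            <⟨ *-monoˡ-< (0<exp x) (begin-strict
      1#                    <⟨ <-by (0<y-x x<y) (solve 2 (λ o x → x := o :+ x :- o) refl 1# (y - x)) ⟩
      1# + (y - x)          ≤⟨ 1+x≤exp (0≤y-x (<⇒≤ x<y)) ⟩
      exp (y - x)           ∎) ⟩
    exp x * exp (y - x)   ≈⟨ exp-split x y ⟨
    exp y                 ∎

  exp-cancel-≤ : exp x ≤ exp y → x ≤ y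
  exp-cancel-≤ {x} {y} ex≤ey with x ≤? y
  ... | yes x≤y = x≤y
  ... | no  x≰y = contradiction ex≤ey (<⇒≱ (exp-mono-< (≰⇒> x≰y)))

  exp-injective : exp x ≈ exp y → x ≈ y
  exp-injective ex≈ey = antisym (exp-cancel-≤ (≤-reflexive ex≈ey)) (exp-cancel-≤ (≤-reflexive (sym ex≈ey)))

  exp-*-fromℕ : ∀ x n → exp (x * fromℕ n) ≈ exp x ^ n
  exp-*-fromℕ x zero    = trans (exp-cong (zeroʳ x)) exp-0
  exp-*-fromℕ x (suc n) = begin-equality
    exp (x * (1# + fromℕ n))     ≈⟨ exp-cong (trans (distribˡ x 1# _) (+-congʳ (*-identityʳ x))) ⟩
    exp (x + x * fromℕ n)        ≈⟨ exp-+ _ _ ⟩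
    exp x * exp (x * fromℕ n)    ≈⟨ *-congˡ (exp-*-fromℕ x n) ⟩
    exp x * exp x ^ n            ∎

-- Open rays and points as Borel sets.

module BorelSets (𝓡 : RealNumbers) where
  open RealNumbers 𝓡
  open OrderedField 𝓡
  open Archimedean 𝓡
  open ≤-Reasoning

  infixr 5 _∷ₛ_
  _∷ₛ_ : ∀ {A : Set} → Pred A 0ℓ → (ℕ → Pred A 0ℓ) → ℕ → Pred A 0ℓ
  (P ∷ₛ Q) zero    = P
  (P ∷ₛ Q) (suc n) = Q n

  borel-∪ : ∀ {B C} → Borel B → Borel C → Borel (B ∪ C)
  borel-∪ {B} {C} b c = resp
    ((λ { (zero , x∈B) → inj₁ x∈B ; (suc _ , x∈C) → inj₂ x∈C }) ,
     λ { (inj₁ x∈B) → 0 , x∈B ; (inj₂ x∈C) → 1 , x∈C })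
    (union {B = B ∷ₛ λ _ → C} λ { zero → b ; (suc _) → c })

  borel-< : ∀ c → Borel (_< c)
  borel-< c = resp ((λ { (n , p) → below n p }) , above)
    (union (λ n → ray (c - fromℕ (suc n) ⁻¹)))
    where
    below : ∀ n {x} → x ≤ c - fromℕ (suc n) ⁻¹ → x < c
    below n {x} x≤ = begin-strict
      x                        ≤⟨ x≤ ⟩
      c - fromℕ (suc n) ⁻¹
        <⟨ <-by (0<x⁻¹ (0<fromℕ (suc n))) (solve 2 (λ c i → i := c :- (c :- i)) refl c _) ⟩
      c                        ∎
    above : ∀ {x} → x < c → ∃ λ n → x ≤ c - fromℕ (suc n) ⁻¹
    above {x} x<c with archimedean ((c - x) ⁻¹)
    ... | n , d⁻¹<n = n , ≤-by (0≤y-x k⁻¹≤d) (solve 3 (λ c x i → c :- x :- i := c :- i :- x) refl c x _)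
      where
      d = c - x
      k = fromℕ (suc n)
      0<k : 0# < k
      0<k = 0<fromℕ (suc n)
      k⁻¹≤d : k ⁻¹ ≤ d
      k⁻¹≤d = *-cancelˡ-≤ 0<k (begin
        k * k ⁻¹     ≈⟨ *-inverseʳ (pos⇒≉0 0<k) ⟩
        1#           ≈⟨ *-inverseʳ (pos⇒≉0 (0<y-x x<c)) ⟨
        d * d ⁻¹     ≤⟨ *-monoˡ-≤ (<⇒≤ (0<y-x x<c)) (<⇒≤ d⁻¹<n) ⟩
        d * fromℕ n
          ≤⟨ *-monoˡ-≤ (<⇒≤ (0<y-x x<c)) (≤-by 0≤1 (solve 2 (λ o k → o := o :+ k :- k) refl 1# (fromℕ n))) ⟩
        d * k        ≈⟨ *-comm d k ⟩
        k * d        ∎)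

  -- Independence speaks of Borel sets, so it applies to outcomes only once points are known to be
  -- Borel.
  borel-≈ : ∀ c → Borel (_≈ c)
  borel-≈ c = resp (to , from) (complement (borel-∪ (complement (ray c)) (borel-< c)))
    where
    to : ∀ {x} → ¬ (¬ x ≤ c ⊎ x < c) → x ≈ c
    to {x} ¬⊎ with x ≤? c | x ≟ c
    ... | no  x≰c | _       = contradiction (inj₁ x≰c) ¬⊎
    ... | yes _   | yes x≈c = x≈c
    ... | yes x≤c | no  x≉c = contradiction (inj₂ (x≤c , x≉c)) ¬⊎
    from : ∀ {x} → x ≈ c → ¬ (¬ x ≤ c ⊎ x < c)
    from x≈c = [ (λ x≰c → x≰c (≤-reflexive x≈c)) , (λ x<c → proj₂ x<c x≈c) ]′

-- Finite additivity, and measurability of sums of random variables.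

module Events (𝓡 : RealNumbers) (𝓟 : ProbabilitySpace 𝓡) where
  open RealNumbers 𝓡
  open ProbabilitySpace 𝓟
  open OrderedField 𝓡
  open Archimedean 𝓡
  open Limit 𝓡
  open BorelSets 𝓡
  open SemiringSum semiring using (sum-cong-≋; sum-replicate-zero)
  open ≤-Reasoning

  private variable
    A B C : Pred Ω 0ℓ
    X Y   : Ω → ℝ

  -- Without excluded middle, the finitary set identities behind additivity hold only for decidable sets.
  record Event (A : Pred Ω 0ℓ) : Set₁ where
    field
      measurable : Measurable A
      decide     : Decidable A
  open Event

  measurable-∅ : Measurable ∅
  measurable-∅ = measurable-resp ((λ ¬⊤ → ¬⊤ _) , λ ()) (measurable-∁ measurable-U)

  pairSequence-∪ : ⋃ ℕ (A ∷ₛ B ∷ₛ λ _ → ∅) ≐ (A ∪ B)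
  pairSequence-∪ = (λ { (0 , a) → inj₁ a ; (1 , b) → inj₂ b }) ,
                   λ { (inj₁ a) → 0 , a ; (inj₂ b) → 1 , b }

  measurable-pairSequence : Measurable A → Measurable B → ∀ k → Measurable ((A ∷ₛ B ∷ₛ λ _ → ∅) k)
  measurable-pairSequence a b 0             = a
  measurable-pairSequence a b 1             = b
  measurable-pairSequence a b (suc (suc _)) = measurable-∅

  measurable-∪ : Measurable A → Measurable B → Measurable (A ∪ B)
  measurable-∪ {A} {B} a b = measurable-resp pairSequence-∪
    (measurable-⋃ {A = A ∷ₛ B ∷ₛ λ _ → ∅} (measurable-pairSequence a b))

  event-∁ : Event A → Event (∁ A)
  event-∁ a = record { measurable = measurable-∁ (measurable a) ; decide = λ ω → ¬? (decide a ω) }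

  event-∪ : Event A → Event B → Event (A ∪ B)
  event-∪ a b = record
    { measurable = measurable-∪ (measurable a) (measurable b)
    ; decide     = λ ω → decide a ω ⊎-dec decide b ω }

  event-∩ : Event A → Event B → Event (A ∩ B)
  event-∩ {A} {B} a b = record
    { measurable = measurable-resp (to , from) (measurable (event-∁ (event-∪ (event-∁ a) (event-∁ b))))
    ; decide     = λ ω → decide a ω ×-dec decide b ω }
    where
    to : ∁ (∁ A ∪ ∁ B) ⊆ A ∩ B
    to {ω} ¬⊎ with decide a ω | decide b ω
    ... | yes ω∈A | yes ω∈B = ω∈A , ω∈B
    ... | no  ω∉A | _       = contradiction (inj₁ ω∉A) ¬⊎
    ... | yes _   | no  ω∉B = contradiction (inj₂ ω∉B) ¬⊎
    from : A ∩ B ⊆ ∁ (∁ A ∪ ∁ B)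
    from (ω∈A , ω∈B) = [ (λ ω∉A → ω∉A ω∈A) , (λ ω∉B → ω∉B ω∈B) ]′

  event-⋂ : ∀ n {A : Fin n → Pred Ω 0ℓ} → (∀ i → Event (A i)) → Event (⋂ (Fin n) A)
  event-⋂ zero    a = record
    { measurable = measurable-resp ((λ _ ()) , λ _ → _) measurable-U
    ; decide     = λ _ → yes λ () }
  event-⋂ (suc n) {A} a = record
    { measurable = measurable-resp ⋂-suc (measurable a₀∩)
    ; decide     = decide-⋂ }
    where
    a₀∩ = event-∩ (a Fin.zero) (event-⋂ n (a ∘ Fin.suc))
    ⋂-suc : A Fin.zero ∩ ⋂ (Fin n) (A ∘ Fin.suc) ≐ ⋂ (Fin (suc n)) A
    ⋂-suc = (λ { (h , t) Fin.zero → h ; (h , t) (Fin.suc i) → t i }) ,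
            λ h → h Fin.zero , (λ i → h (Fin.suc i))
    decide-⋂ : Decidable (⋂ (Fin (suc n)) A)
    decide-⋂ ω with decide a₀∩ ω
    ... | yes h  = yes (proj₁ ⋂-suc h)
    ... | no  ¬h = no λ h → ¬h (proj₂ ⋂-suc h)

  -- Countable additivity is applied to A, B, ∅, ∅, ..., whose partial sums are constant from index
  -- 2 on.
  ℙ-∪ : Measurable A → Measurable B → A ⊥ B → ℙ (A ∪ B) ≈ ℙ A + ℙ B
  ℙ-∪ {A} {B} a b A⊥B = begin-equality
    ℙ (A ∪ B)     ≈⟨ ℙ-cong pairSequence-∪ ⟨
    ℙ (⋃ ℕ F)     ≈⟨ ⟶-unique (ℙ-union {A = F} (measurable-pairSequence a b) (λ {j} {k} → disjoint j k))
                              (eventually-const⟶ 2 partialSum-F) (λ _ → refl) ⟩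
    ℙ A + ℙ B     ∎
    where
    F = A ∷ₛ B ∷ₛ λ _ → ∅
    disjoint : ∀ j k → ¬ j ≡ k → F j ⊥ F k
    disjoint 0             0             0≢0 _       = 0≢0 ≡.refl
    disjoint 0             1             _   p       = A⊥B p
    disjoint 0             (suc (suc _)) _   (_ , q) = q
    disjoint 1             0             _   (q , p) = A⊥B (p , q)
    disjoint 1             1             1≢1 _       = 1≢1 ≡.refl
    disjoint 1             (suc (suc _)) _   (_ , q) = q
    disjoint (suc (suc _)) _             _   (p , _) = p
    partialSum-F : ∀ n → partialSum (λ k → ℙ (F k)) (2 ℕ.+ n) ≈ ℙ A + ℙ B
    partialSum-F n = +-congˡ (trans
      (+-congˡ (trans (sum-cong-≋ {n} (λ _ → ℙ-∅)) (sum-replicate-zero n)))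
      (+-identityʳ (ℙ B)))

  ℙ-mono : Event A → Event B → A ⊆ B → ℙ A ≤ ℙ B
  ℙ-mono {A} {B} a b A⊆B = begin
    ℙ A                  ≈⟨ +-identityʳ _ ⟨
    ℙ A + 0#             ≤⟨ +-mono-≤ ≤-refl (ℙ-nonNeg (measurable b∖a)) ⟩
    ℙ A + ℙ (B ∩ ∁ A)    ≈⟨ ℙ-∪ (measurable a) (measurable b∖a) (λ (ω∈A , _ , ω∉A) → ω∉A ω∈A) ⟨
    ℙ (A ∪ (B ∩ ∁ A))    ≈⟨ ℙ-cong ([ A⊆B , proj₁ ]′ , split) ⟩
    ℙ B                  ∎
    where
    b∖a = event-∩ b (event-∁ a)
    split : B ⊆ A ∪ (B ∩ ∁ A)
    split {ω} ω∈B with decide a ω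
    ... | yes ω∈A = inj₁ ω∈A
    ... | no  ω∉A = inj₂ (ω∈B , ω∉A)

  ℙ-∁ : Event A → ℙ A + ℙ (∁ A) ≈ 1#
  ℙ-∁ {A} a = begin-equality
    ℙ A + ℙ (∁ A)   ≈⟨ ℙ-∪ (measurable a) (measurable (event-∁ a)) (λ (ω∈A , ω∉A) → ω∉A ω∈A) ⟨
    ℙ (A ∪ ∁ A)     ≈⟨ ℙ-cong ((λ _ → _) , λ {ω} _ → dichotomy ω) ⟩
    ℙ U             ≈⟨ ℙ-U ⟩
    1#              ∎
    where
    dichotomy : ∀ ω → A ω ⊎ ¬ A ω
    dichotomy ω with decide a ω
    ... | yes ω∈A = inj₁ ω∈A
    ... | no  ω∉A = inj₂ ω∉A

  -- B and C need not cover Ω, but what they miss is a null event. With B and C the events that a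
  -- trial equals 1 or 0, this accommodates trials that take other values with probability 0.
  ℙ-split : Event A → Event B → Event C → B ⊥ C → ℙ B + ℙ C ≈ 1# →
            ℙ A ≤ ℙ (A ∩ B) + ℙ (A ∩ C)
  ℙ-split {A} {B} {C} a b c B⊥C B+C≈1 = begin
    ℙ A                                  ≤⟨ ℙ-mono a (event-∪ (event-∪ ab ac) null) cover ⟩
    ℙ (((A ∩ B) ∪ (A ∩ C)) ∪ ∁ (B ∪ C))  ≈⟨ ℙ-∪ (measurable (event-∪ ab ac)) (measurable null)
                                              (λ { (inj₁ (_ , ω∈B) , ω∉) → ω∉ (inj₁ ω∈B)
                                                 ; (inj₂ (_ , ω∈C) , ω∉) → ω∉ (inj₂ ω∈C) }) ⟩
    ℙ ((A ∩ B) ∪ (A ∩ C)) + ℙ (∁ (B ∪ C)) ≈⟨ +-cong (ℙ-∪ (measurable ab) (measurable ac)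
                                              (λ ((_ , ω∈B) , (_ , ω∈C)) → B⊥C (ω∈B , ω∈C))) ℙnull≈0 ⟩
    ℙ (A ∩ B) + ℙ (A ∩ C) + 0#           ≈⟨ +-identityʳ _ ⟩
    ℙ (A ∩ B) + ℙ (A ∩ C)                ∎
    where
    ab = event-∩ a b
    ac = event-∩ a c
    null = event-∁ (event-∪ b c)
    cover : A ⊆ ((A ∩ B) ∪ (A ∩ C)) ∪ ∁ (B ∪ C)
    cover {ω} ω∈A with decide (event-∪ b c) ω
    ... | yes (inj₁ ω∈B) = inj₁ (inj₁ (ω∈A , ω∈B))
    ... | yes (inj₂ ω∈C) = inj₁ (inj₂ (ω∈A , ω∈C))
    ... | no  ω∉         = inj₂ ω∉
    ℙnull≈0 : ℙ (∁ (B ∪ C)) ≈ 0#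
    ℙnull≈0 = begin-equality
      ℙ (∁ (B ∪ C))
        ≈⟨ solve 2 (λ x y → y := (x :+ y) :- x) refl (ℙ (B ∪ C)) _ ⟩
      (ℙ (B ∪ C) + ℙ (∁ (B ∪ C))) - ℙ (B ∪ C)
        ≈⟨ +-cong (ℙ-∁ (event-∪ b c)) (-‿cong (trans (ℙ-∪ (measurable b) (measurable c) B⊥C) B+C≈1)) ⟩
      1# - 1#                                     ≈⟨ -‿inverseʳ 1# ⟩
      0#                                          ∎

  infix 4 _<?_
  _<?_ : ∀ x y → Dec (x < y)
  x <? y with y ≤? x
  ... | yes y≤x = no λ x<y → <⇒≱ x<y y≤x
  ... | no  y≰x = yes (≰⇒> y≰x)

  -- The strict inequality is what passes to sums: it leaves room for a rational between the two
  -- summands' constraints. With a non-strict one, equality at an irrational point would escape the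
  -- countable union.
  ExceedanceMeasurable : (Ω → ℝ) → Set₁
  ExceedanceMeasurable X = ∀ a → Measurable (λ ω → a < X ω)

  exceedance-event : ExceedanceMeasurable X → ∀ a → Event (λ ω → a < X ω)
  exceedance-event {X} mX a = record { measurable = mX a ; decide = λ ω → a <? X ω }

  randomVariable-exceedance : IsRandomVariable X → ExceedanceMeasurable X
  randomVariable-exceedance rv a = rv (resp (≰⇒> , <⇒≱) (complement (ray a)))

  -- a < x + y holds iff some rational q satisfies q < x and a - q < y.
  exceedance-+ : ExceedanceMeasurable X → ExceedanceMeasurable Y → ExceedanceMeasurable (λ ω → X ω + Y ω)
  exceedance-+ {X} {Y} mX mY a = measurable-resp
    ((λ {ω} (j , m , k , p) → to (fraction j m k) (X ω) (Y ω) p) , λ {ω} → from (X ω) (Y ω))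
    (measurable-⋃ λ j → measurable-⋃ λ m → measurable-⋃ λ k →
      measurable (event-∩ (exceedance-event mX (fraction j m k)) (exceedance-event mY
        (a - fraction j m k))))
    where
    to : ∀ q x y → q < x × a - q < y → a < x + y
    to q x y (q<x , a-q<y) = <-by (0<x+y (0<y-x q<x) (<⇒≤ (0<y-x a-q<y)))
      (solve 4 (λ a q x y → (x :- q) :+ (y :- (a :- q)) := x :+ y :- a) refl a q x y)
    a-y<x : ∀ x y → a < x + y → a - y < x
    a-y<x x y a<x+y = <-by (0<y-x a<x+y) (solve 3 (λ a x y → x :+ y :- a := x :- (a :- y)) refl a x y)
    a-q<y : ∀ q y → a - y < q → a - q < y
    a-q<y q y a-y<q = <-by (0<y-x a-y<q) (solve 3 (λ a q y → q :- (a :- y) := y :- (a :- q)) refl a q y)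
    from : ∀ x y → a < x + y → ∃ λ j → ∃ λ m → ∃ λ k → fraction j m k < x × a - fraction j m k < y
    from x y a<x+y =
      let j , m , k , a-y<q , q<x = fraction-dense (a-y<x x y a<x+y)
      in j , m , k , q<x , a-q<y (fraction j m k) y a-y<q

  exceedance-∑ : ∀ n (X : Fin n → Ω → ℝ) → (∀ i → ExceedanceMeasurable (X i)) → ExceedanceMeasurable (∑ X)
  exceedance-∑ zero    X mX a with a <? 0#
  ... | yes a<0 = measurable-resp ((λ _ → a<0) , λ _ → _) measurable-U
  ... | no  a≮0 = measurable-resp ((λ ()) , a≮0) measurable-∅
  exceedance-∑ (suc n) X mX = exceedance-+ (mX Fin.zero) (exceedance-∑ n (X ∘ Fin.suc) (mX ∘ Fin.suc))

  event-∑≤ : ∀ n (X : Fin n → Ω → ℝ) → (∀ i → IsRandomVariable (X i)) → ∀ a → Event (λ ω → ∑ X ω ≤ a)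
  event-∑≤ n X rv a = record
    { measurable = measurable-resp ((λ a≮ → ≮⇒≥ a≮) , λ ≤a a< → <⇒≱ a< ≤a)
        (measurable-∁ (exceedance-∑ n X (λ i → randomVariable-exceedance (rv i)) a))
    ; decide = λ ω → ∑ X ω ≤? a }
    where
    ≮⇒≥ : ∀ {x} → ¬ a < x → x ≤ a
    ≮⇒≥ {x} a≮x with x ≤? a
    ... | yes x≤a = x≤a
    ... | no  x≰a = contradiction (≰⇒> x≰a) a≮x

-- Bernoulli weights.

module Bernoulli (𝓡 : RealNumbers) where
  open RealNumbers 𝓡
  open OrderedField 𝓡

  value : Bool → ℝ
  value true  = 1#
  value false = 0#

  weight : ℝ → Bool → ℝ
  weight p true  = p
  weight p false = 1# - p

  weight-sum : ∀ p → weight p true + weight p false ≈ 1#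
  weight-sum p = solve 2 (λ p o → p :+ (o :- p) := o) refl p 1#

-- Outcomes of independent Bernoulli trials.

module BernoulliTrials (𝓡 : RealNumbers) (𝓟 : ProbabilitySpace 𝓡) where
  open RealNumbers 𝓡
  open ProbabilitySpace 𝓟
  open OrderedField 𝓡
  open BorelSets 𝓡
  open Events 𝓡 𝓟
  open Bernoulli 𝓡
  open MonoidSum *-monoid using () renaming (sum-cong-≋ to product-cong)
  open ≤-Reasoning

  Outcome : ∀ {n} → (Fin n → Ω → ℝ) → (Fin n → Bool) → Pred Ω 0ℓ
  Outcome {n} X v = ⋂ (Fin n) (λ i ω → X i ω ≈ value (v i))

  event-value : ∀ {X} → IsRandomVariable X → ∀ c → Event (λ ω → X ω ≈ c)
  event-value {X} rv c = record { measurable = rv (borel-≈ c) ; decide = λ ω → X ω ≟ c }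

  -- The hypothesis is summed over all 2ⁿ outcomes v, the right-hand sides adding up to C.
  ℙ≤-by-outcomes : ∀ n (X : Fin n → Ω → ℝ) → (∀ i → IsRandomVariable (X i)) →
    (∀ i → ℙ (λ ω → X i ω ≈ 1#) + ℙ (λ ω → X i ω ≈ 0#) ≈ 1#) →
    ∀ (g : Bool → ℝ) → g true + g false ≈ 1# → ∀ {A} (C : ℝ) → Event A →
    (∀ v → ℙ (A ∩ Outcome X v) ≤ C * product (g ∘ v)) → ℙ A ≤ C
  ℙ≤-by-outcomes zero X _ _ g _ {A} C _ dominated = begin
    ℙ A                              ≈⟨ ℙ-cong ((λ ω∈A → ω∈A , λ ()) , proj₁) ⟩
    ℙ (A ∩ Outcome X (λ ()))         ≤⟨ dominated (λ ()) ⟩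
    C * 1#                           ≈⟨ *-identityʳ C ⟩
    C                                ∎
  ℙ≤-by-outcomes (suc n) X rv total g g≈1 {A} C a dominated = begin
    ℙ A                              ≤⟨ ℙ-split a (head-event true) (head-event false)
                                          (λ (≈1 , ≈0) → 0≉1 (trans (sym ≈0) ≈1)) (total Fin.zero) ⟩
    ℙ (A ∩ Head true) + ℙ (A ∩ Head false)
                                     ≤⟨ +-mono-≤ (conditioned true) (conditioned false) ⟩
    C * g true + C * g false         ≈⟨ distribˡ C _ _ ⟨
    C * (g true + g false)           ≈⟨ *-congˡ g≈1 ⟩
    C * 1#                           ≈⟨ *-identityʳ C ⟩
    C                                ∎
    where
    Head : Bool → Pred Ω 0ℓ
    Head b ω = X Fin.zero ω ≈ value b
    head-event : ∀ b → Event (Head b)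
    head-event b = event-value (rv Fin.zero) (value b)
    conditioned : ∀ b → ℙ (A ∩ Head b) ≤ C * g b
    -- The first trial is absorbed into the parameters: A shrinks to A ∩ Head b and C is multiplied
    -- by g b. This is why the induction runs over arbitrary events A and constants C.
    conditioned b = ℙ≤-by-outcomes n (X ∘ Fin.suc) (rv ∘ Fin.suc) (total ∘ Fin.suc) g g≈1
      (C * g b) (event-∩ a (head-event b)) λ v → begin
        ℙ ((A ∩ Head b) ∩ Outcome (X ∘ Fin.suc) v)  ≈⟨ ℙ-cong
          ((λ { ((ω∈A , h) , t) → ω∈A , λ { Fin.zero → h ; (Fin.suc i) → t i } }) ,
           λ { (ω∈A , o) → (ω∈A , o Fin.zero) , λ i → o (Fin.suc i) }) ⟩
        ℙ (A ∩ Outcome X (b ∷ v))                   ≤⟨ dominated (b ∷ v) ⟩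
        C * (g b * product (g ∘ v))                 ≈⟨ *-assoc C _ _ ⟨
        C * g b * product (g ∘ v)                   ∎

  ℙ-value : ∀ {X p} → X ∼b p → ∀ b → ℙ (λ ω → X ω ≈ value b) ≈ weight p b
  ℙ-value X∼bp true  = _∼b_.ℙ-one X∼bp
  ℙ-value X∼bp false = _∼b_.ℙ-zero X∼bp

  ℙ-Outcome : ∀ {n} {X : Fin n → Ω → ℝ} {p} → Independent X → (∀ i → X i ∼b p) →
              ∀ v → ℙ (Outcome X v) ≈ product (weight p ∘ v)
  ℙ-Outcome {n} independent X∼bp v = trans (independent _ (λ i → borel-≈ (value (v i))))
    (product-cong {n} (λ i → ℙ-value (X∼bp i) (v i)))

-- The likelihood ratio between the parameters r and p.

module ChangeOfMeasure (𝓡 : RealNumbers) (𝓔 : ExpLog 𝓡) where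
  open RealNumbers 𝓡
  open ExpLog 𝓔
  open OrderedField 𝓡
  open Archimedean 𝓡
  open Exponential 𝓡 𝓔
  open Bernoulli 𝓡
  open SemiringExp semiring using (^-congˡ)
  open ≤-Reasoning

  private variable x y : ℝ

  product-nonNeg : ∀ {n} {x : Fin n → ℝ} → (∀ i → 0# ≤ x i) → 0# ≤ product x
  product-nonNeg {zero}  0≤x = 0≤1
  product-nonNeg {suc n} 0≤x = *-nonNegative (0≤x Fin.zero) (product-nonNeg (0≤x ∘ Fin.suc))

  0<x/y : 0# < x → 0# < y → 0# < x / y
  0<x/y 0<x 0<y = 0<x*y 0<x (0<x⁻¹ 0<y)

  y*[x/y]≈x : 0# < y → y * (x / y) ≈ x
  y*[x/y]≈x {y} {x} 0<y = begin-equality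
    y * (x * y ⁻¹)  ≈⟨ solve 3 (λ x y i → y :* (x :* i) := x :* (y :* i)) refl x y (y ⁻¹) ⟩
    x * (y * y ⁻¹)  ≈⟨ *-congˡ (*-inverseʳ (pos⇒≉0 0<y)) ⟩
    x * 1#          ≈⟨ *-identityʳ x ⟩
    x               ∎

  -- As `ln` is characterised by `exp-ln`, an identity between logarithms is checked after applying
  -- `exp`, which is injective.
  ln-flip : 0# < x → 0# < y → ln (x / y) ≈ - ln (y / x)
  ln-flip {x} {y} 0<x 0<y = exp-injective (*-cancelˡ (pos⇒≉0 (0<x/y 0<y 0<x)) (begin-equality
    y / x * exp (ln (x / y))              ≈⟨ *-congˡ (exp-ln (0<x/y 0<x 0<y)) ⟩
    y / x * (x / y)
      ≈⟨ solve 4 (λ x y i j → y :* i :* (x :* j) := (x :* i) :* (y :* j)) refl x y (x ⁻¹) (y ⁻¹) ⟩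
    x * x ⁻¹ * (y * y ⁻¹)                 ≈⟨ *-cong (*-inverseʳ (pos⇒≉0 0<x)) (*-inverseʳ (pos⇒≉0 0<y)) ⟩
    1# * 1#                               ≈⟨ *-identityˡ 1# ⟩
    1#                                    ≈⟨ exp-inverse (ln (y / x)) ⟨
    exp (ln (y / x)) * exp (- ln (y / x)) ≈⟨ *-congʳ (exp-ln (0<x/y 0<y 0<x)) ⟩
    y / x * exp (- ln (y / x))            ∎))

  exp-D : ∀ {r p} → 0# < r → 0# < p → 0# < 1# - r → 0# < 1# - p → ∀ n →
    exp (- D r p * fromℕ n) ≈ ((p / r) ^ʳ r * ((1# - p) / (1# - r)) ^ʳ (1# - r)) ^ n
  exp-D {r} {p} 0<r 0<p 0<1-r 0<1-p n = trans (exp-*-fromℕ (- D r p) n) (^-congˡ n (begin-equality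
    exp (- D r p)
      ≈⟨ exp-cong (solve 4 (λ r s x y → :- (r :* x :+ s :* y) := r :* :- x :+ s :* :- y)
        refl r (1# - r) _ _) ⟩
    exp (r * - ln (r / p) + (1# - r) * - ln ((1# - r) / (1# - p)))
      ≈⟨ exp-cong (+-cong (*-congˡ (ln-flip 0<p 0<r)) (*-congˡ (ln-flip 0<1-p 0<1-r))) ⟨
    exp (r * ln (p / r) + (1# - r) * ln ((1# - p) / (1# - r)))
      ≈⟨ exp-+ _ _ ⟩
    (p / r) ^ʳ r * ((1# - p) / (1# - r)) ^ʳ (1# - r) ∎))

  module _ {p r : ℝ} (0<r : 0# < r) (r<p : r < p) (p<1 : p < 1#) where

    0<p : 0# < p
    0<p = begin-strict 0# <⟨ 0<r ⟩ r <⟨ r<p ⟩ p ∎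

    1-p<1-r : 1# - p < 1# - r
    1-p<1-r = <-by (0<y-x r<p) (solve 3 (λ o p r → p :- r := (o :- r) :- (o :- p)) refl 1# p r)

    0<1-p : 0# < 1# - p
    0<1-p = 0<y-x p<1

    0<1-r : 0# < 1# - r
    0<1-r = begin-strict 0# <⟨ 0<1-p ⟩ 1# - p <⟨ 1-p<1-r ⟩ 1# - r ∎

    0<weight : ∀ b → 0# < weight p b
    0<weight true  = 0<p
    0<weight false = 0<1-p

    0<weight-r : ∀ b → 0# < weight r b
    0<weight-r true  = 0<r
    0<weight-r false = 0<1-r

    logRatio : Bool → ℝ
    logRatio b = ln (weight r b / weight p b)

    weight*exp-logRatio : ∀ b → weight p b * exp (logRatio b) ≈ weight r b
    weight*exp-logRatio b = trans (*-congˡ (exp-ln (0<x/y (0<weight-r b) (0<weight b)))) (y*[x/y]≈x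
      (0<weight b))

    logRatio-true≤false : logRatio true ≤ logRatio false
    logRatio-true≤false = exp-cancel-≤ (begin
      exp (logRatio true)    ≈⟨ exp-ln (0<x/y 0<r 0<p) ⟩
      r / p                  ≤⟨ *-monoʳ-≤ (<⇒≤ (0<x⁻¹ 0<p)) (<⇒≤ r<p) ⟩
      p / p                  ≈⟨ *-inverseʳ (pos⇒≉0 0<p) ⟩
      1#                     ≈⟨ *-inverseʳ (pos⇒≉0 0<1-p) ⟨
      (1# - p) / (1# - p)    ≤⟨ *-monoʳ-≤ (<⇒≤ (0<x⁻¹ 0<1-p)) (<⇒≤ 1-p<1-r) ⟩
      (1# - r) / (1# - p)    ≈⟨ exp-ln (0<x/y 0<1-r 0<1-p) ⟨
      exp (logRatio false)   ∎)

    -- Interpolating between the two values makes the sum over all trials depend on the number of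
    -- ones alone.
    logRatio-affine : ∀ b → logRatio b ≈ logRatio false + (logRatio true - logRatio false) * value b
    logRatio-affine true  = trans (solve 2 (λ t f → t := f :+ (t :- f))
      refl (logRatio true) (logRatio false))
                                  (+-congˡ (sym (*-identityʳ _)))
    logRatio-affine false = sym (trans (+-congˡ (zeroʳ _)) (+-identityʳ _))

    sum-logRatio : ∀ n (v : Fin n → Bool) →
      sum (logRatio ∘ v) ≈ fromℕ n * logRatio false + (logRatio true - logRatio false) * sum (value ∘ v)
    sum-logRatio zero    v = solve 2 (λ f d → con (+ 0) := con (+ 0) :* f :+ d :* con (+ 0)) refl _ _
    sum-logRatio (suc n) v = begin-equality
      logRatio (v Fin.zero) + sum (logRatio ∘ v ∘ Fin.suc)
        ≈⟨ +-cong (logRatio-affine (v Fin.zero)) (sum-logRatio n (v ∘ Fin.suc)) ⟩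
      (f + d * z) + (fromℕ n * f + d * s)
        ≈⟨ +-congʳ (+-congʳ (*-identityˡ f)) ⟨
      (1# * f + d * z) + (fromℕ n * f + d * s)
        ≈⟨ solve 6 (λ o k f d x s → (o :* f :+ d :* x) :+ (k :* f :+ d :* s)
          := (o :+ k) :* f :+ d :* (x :+ s)) refl 1# (fromℕ n) f d z s ⟩
      fromℕ (suc n) * f + d * (z + s) ∎
      where
      f = logRatio false
      d = logRatio true - logRatio false
      z = value (v Fin.zero)
      s = sum (value ∘ v ∘ Fin.suc)

    product-weight-r : ∀ n (v : Fin n → Bool) →
      product (weight r ∘ v) ≈ product (weight p ∘ v) * exp (sum (logRatio ∘ v))
    product-weight-r zero    v = sym (trans (*-identityˡ _) exp-0)
    product-weight-r (suc n) v = begin-equality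
      weight r (v Fin.zero) * product (weight r ∘ v ∘ Fin.suc)
        ≈⟨ *-cong (sym (weight*exp-logRatio (v Fin.zero))) (product-weight-r n (v ∘ Fin.suc)) ⟩
      w * exp l * (π * exp s)
        ≈⟨ solve 4 (λ a b c d → a :* b :* (c :* d) := a :* c :* (b :* d)) refl w (exp l) π (exp s) ⟩
      w * π * (exp l * exp s)  ≈⟨ *-congˡ (exp-+ l s) ⟨
      w * π * exp (l + s)      ∎
      where
      w = weight p (v Fin.zero)
      l = logRatio (v Fin.zero)
      π = product (weight p ∘ v ∘ Fin.suc)
      s = sum (logRatio ∘ v ∘ Fin.suc)

    D*n≤sum-logRatio : ∀ n (v : Fin n → Bool) → sum (value ∘ v) ≤ r * fromℕ n →
      D r p * fromℕ n ≤ sum (logRatio ∘ v)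
    D*n≤sum-logRatio n v s≤rn = begin
      D r p * k
        -- `k * f + (t - f) * s` is affine in s with slope t - f ≤ 0 and takes the value `D r p * k`
        -- at s = r k. The gap is therefore exactly (f - t)(r k - s), a product of nonnegative
        -- factors.
        ≤⟨ ≤-by (*-nonNegative (0≤y-x logRatio-true≤false) (0≤y-x s≤rn)) (begin-equality
        (f - t) * (r * k - s)
          ≈⟨ solve 5 (λ f t r k s → (f :- t) :* (r :* k :- s)
               := k :* f :+ (t :- f) :* s :- (r :* t :+ (con (+ 1) :- r) :* f) :* k) refl f t r k s ⟩
        k * f + (t - f) * s - D r p * k ∎) ⟩
      k * f + (t - f) * s        ≈⟨ sum-logRatio n v ⟨
      sum (logRatio ∘ v)         ∎
      where
      f = logRatio false
      t = logRatio true
      k = fromℕ n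
      s = sum (value ∘ v)

    product-weight-≤ : ∀ n (v : Fin n → Bool) → sum (value ∘ v) ≤ r * fromℕ n →
      product (weight p ∘ v) ≤ exp (- D r p * fromℕ n) * product (weight r ∘ v)
    product-weight-≤ n v s≤rn = begin
      π                          ≈⟨ *-identityʳ π ⟨
      π * 1#
        ≤⟨ *-monoˡ-≤ (product-nonNeg {n} (<⇒≤ ∘ 0<weight ∘ v)) (1≤exp (0≤y-x (D*n≤sum-logRatio n v s≤rn))) ⟩
      π * exp (s - D r p * k)
        ≈⟨ *-congˡ (trans (exp-cong (solve 3 (λ s d k → s :- d :* k := (:- d :* k) :+ s)
          refl s (D r p) k)) (exp-+ _ _)) ⟩
      π * (e * exp s)            ≈⟨ solve 3 (λ a b c → a :* (b :* c) := b :* (a :* c)) refl π e (exp s) ⟩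
      e * (π * exp s)            ≈⟨ *-congˡ (product-weight-r n v) ⟨
      e * product (weight r ∘ v) ∎
      where
      k = fromℕ n
      e = exp (- D r p * k)
      π = product (weight p ∘ v)
      s = sum (logRatio ∘ v)

-- The Chernoff bound for the lower tail.

lemma7 :
    (𝓡 : RealNumbers) (𝓔 : ExpLog 𝓡) (𝓟 : ProbabilitySpace 𝓡) →
    let open RealNumbers 𝓡
        open ExpLog 𝓔
        open ProbabilitySpace 𝓟
    in
    (p : ℝ) → 0# < p → p < 1# →
    (n : ℕ) → 1 ℕ.≤ n →
    (X : Fin n → Ω → ℝ) →
    (∀ i → IsRandomVariable (X i)) →
    Independent X →
    (∀ i → X i ∼b p) →
    (r : ℝ) → 0# < r → r < p →
    (ℙ (λ ω → ∑ X ω ≤ r * fromℕ n) ≤ exp (- D r p * fromℕ n))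
    ×
    (exp (- D r p * fromℕ n)
      ≈ ((p / r) ^ʳ r * ((1# - p) / (1# - r)) ^ʳ (1# - r)) ^ n)
lemma7 𝓡 𝓔 𝓟 p 0<p p<1 n _ X rv independent X∼bp r 0<r r<p =
  ℙ≤-by-outcomes n X rv oneOrZero (weight r) (weight-sum r) C tail dominated ,
  exp-D 0<r 0<p (0<1-r 0<r r<p p<1) (0<1-p 0<r r<p p<1) n
  where
  open RealNumbers 𝓡
  open ExpLog 𝓔
  open ProbabilitySpace 𝓟
  open OrderedField 𝓡
  open Exponential 𝓡 𝓔
  open Events 𝓡 𝓟
  open Bernoulli 𝓡
  open BernoulliTrials 𝓡 𝓟
  open ChangeOfMeasure 𝓡 𝓔 using (exp-D; 0<1-p; 0<1-r; 0<weight-r; product-nonNeg; product-weight-≤)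
  open SemiringSum semiring using (sum-cong-≋)
  open ≤-Reasoning

  C : ℝ
  C = exp (- D r p * fromℕ n)

  Tail : Pred Ω 0ℓ
  Tail ω = ∑ X ω ≤ r * fromℕ n

  tail : Event Tail
  tail = event-∑≤ n X rv (r * fromℕ n)

  oneOrZero : ∀ i → ℙ (λ ω → X i ω ≈ 1#) + ℙ (λ ω → X i ω ≈ 0#) ≈ 1#
  oneOrZero i = trans (+-cong (ℙ-value (X∼bp i) true) (ℙ-value (X∼bp i) false)) (weight-sum p)

  dominated : ∀ v → ℙ (Tail ∩ Outcome X v) ≤ C * product (weight r ∘ v)
  dominated v with sum (value ∘ v) ≤? r * fromℕ n
  ... | yes s≤rn = begin
    ℙ (Tail ∩ Outcome X v)       ≤⟨ ℙ-mono (event-∩ tail outcome) outcome proj₂ ⟩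
    ℙ (Outcome X v)              ≈⟨ ℙ-Outcome independent X∼bp v ⟩
    product (weight p ∘ v)       ≤⟨ product-weight-≤ 0<r r<p p<1 n v s≤rn ⟩
    C * product (weight r ∘ v)   ∎
    where
    outcome : Event (Outcome X v)
    outcome = event-⋂ n (λ i → event-value (rv i) (value (v i)))
  -- On the outcome v the sum of the trials equals the number of ones in v, so the tail is disjoint
  -- from it and the bound only has to be nonnegative.
  ... | no  s≰rn = begin
    ℙ (Tail ∩ Outcome X v)
      ≈⟨ ℙ-cong ((λ (≤rn , o) → s≰rn (≤-respˡ-≈ (sum-cong-≋ {n} o) ≤rn)) , λ ()) ⟩
    ℙ ∅                          ≈⟨ ℙ-∅ ⟩
    0#
      ≤⟨ *-nonNegative (<⇒≤ (0<exp _)) (product-nonNeg {n} (<⇒≤ ∘ 0<weight-r 0<r r<p p<1 ∘ v)) ⟩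
    C * product (weight r ∘ v)   ∎
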